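{- Define $G_{2n}(q)$ for $n\ge1$ by \[ \sum_{n\ge1}G_{2n}(q)z^{n-1}=\cfrac{1}{1-\cfrac{\lambda_1z}{1-\cfrac{\lambda_2z}{1-\cdots}}},\qquad \lambda_{2m-1}=[m]_q^2,\quad \lambda_{2m}=[m]_q[m+1]_q\ (m\ge1). \] For integers $k\ge -1$ let $P_k=\sum_{i=0}^{k}(-1)^i(2i+1)q^{\binom{k+1}{2}-\binom{i+1}{2}}$ (so $P_{ -1}=0$), and for $k\ge0$ let $Y_k=\dfrac{P_{k-1}+2P_k+P_{k+1}}{q-1}$. Then each $Y_k$ is a polynomial in $q$, and for every $n\ge0$, \[ G_{2n+2}(q)=\frac{1}{(1-q)^{2n}}\sum_{k=0}^{n}\left(\binom{2n}{n-k}-\binom{2n}{n-k-1}\right)Y_k. \]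
   Context: $[m]_q=(1-q^m)/(1-q)$. The continued fraction is a formal power series in $z$ (limit of its finite truncations). Binomial coefficients with negative lower index are $0$. -}

module Defs where

open import Data.Nat as ℕ using (ℕ; zero; suc; _≤_)
open import Data.Nat.Combinatorics using (_C_)
open import Data.Integer as ℤ using (ℤ; +_; -[1+_])
open import Data.List using (List; []; _∷_; replicate; _++_)
open import Relation.Binary.PropositionalEquality using (_≡_)
open import Data.Product using (Σ; ∃; _×_)

-- Polynomials in q with integer coefficients:
-- coefficient lists, lowest degree first.

Poly : Set
Poly = List ℤ

coeff : Poly → ℕ → ℤ
coeff []       _       = + 0
coeff (a ∷ p)  zero    = a
coeff (a ∷ p)  (suc i) = coeff p i

infix 4 _≈_
_≈_ : Poly → Poly → Set
p ≈ r = ∀ i → coeff p i ≡ coeff r i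

infixl 6 _⊕_ _⊖_
infixl 7 _⊛_ _·_

_⊕_ : Poly → Poly → Poly
[]      ⊕ r       = r
p       ⊕ []      = p
(a ∷ p) ⊕ (b ∷ r) = (a ℤ.+ b) ∷ (p ⊕ r)

_·_ : ℤ → Poly → Poly
c · []      = []
c · (a ∷ p) = (c ℤ.* a) ∷ (c · p)

⊝_ : Poly → Poly
⊝ p = ℤ.- (+ 1) · p

_⊖_ : Poly → Poly → Poly
p ⊖ r = p ⊕ (⊝ r)

_⊛_ : Poly → Poly → Poly
[]      ⊛ r = []
(a ∷ p) ⊛ r = (a · r) ⊕ (+ 0 ∷ (p ⊛ r))

0P : Poly
0P = []

1P : Poly
1P = + 1 ∷ []

qP : Poly
qP = + 0 ∷ + 1 ∷ []

qpow : ℕ → Poly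
qpow e = replicate e (+ 0) ++ (+ 1 ∷ [])

_^P_ : Poly → ℕ → Poly
p ^P zero  = 1P
p ^P suc n = p ⊛ (p ^P n)

sumP : ℕ → (ℕ → Poly) → Poly
sumP zero    f = 0P
sumP (suc n) f = sumP n f ⊕ f n

-- q-integer [m]_q = (1 - q^m)/(1 - q) = 1 + q + ... + q^(m-1)
qint : ℕ → Poly
qint m = replicate m (+ 1)

-- Continued fraction coefficients  λ_i  (i ≥ 1);  λ 0 is unused.
--   λ_{2m-1} = [m]^2 ,  λ_{2m} = [m][m+1]

lamAt : ℕ → ℕ → Poly
lamAt m zero          = qint m ⊛ qint m
lamAt m (suc zero)    = qint m ⊛ qint (suc m)
lamAt m (suc (suc j)) = lamAt (suc m) j

lam : ℕ → Poly
lam zero    = 0P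
lam (suc i) = lamAt 1 i

Series : Set
Series = ℕ → Poly

oneS : Series
oneS zero    = 1P
oneS (suc _) = 0P

mulS : Series → Series → Series
mulS A B n = sumP (suc n) (λ i → A i ⊛ B (n ℕ.∸ i))

zS : Series → Series
zS A zero    = 0P
zS A (suc n) = A n

powS : Series → ℕ → Series
powS A zero    = oneS
powS A (suc k) = mulS A (powS A k)

-- 1 / (1 - z A) = Σ_k (z A)^k ; the coefficient of z^n only needs k ≤ n
geoS : Series → Series
geoS A n = sumP (suc n) (λ k → powS (zS A) k n)

scaleS : Poly → Series → Series
scaleS p A n = p ⊛ A n

-- Finite truncation of depth d of the continued fraction starting at level j:
--   cfTrunc d j = 1/(1 - λ_{j+1} z/(1 - ... /(1 - λ_{j+d} z)))
cfTrunc : ℕ → ℕ → Series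
cfTrunc zero    j = oneS
cfTrunc (suc d) j = geoS (scaleS (lam (suc j)) (cfTrunc d (suc j)))

-- coefficient of z^n in the depth-d truncation: approximant of G_{2n+2}(q)
Gtrunc : ℕ → ℕ → Poly
Gtrunc d n = cfTrunc d 0 n

signZ : ℕ → ℤ
signZ zero    = + 1
signZ (suc i) = ℤ.- signZ i

-- Psh j = P_{j-1} = Σ_{i=0}^{j-1} (-1)^i (2i+1) q^{C(j,2) - C(i+1,2)}
-- (so Psh 0 = P_{-1} = 0)
Psh : ℕ → Poly
Psh j = sumP j (λ i → (signZ i ℤ.* + (suc (2 ℕ.* i))) · qpow ((j C 2) ℕ.∸ (suc i C 2)))

Ynum : ℕ → Poly
Ynum k = Psh k ⊕ (+ 2 · Psh (suc k)) ⊕ Psh (suc (suc k))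

binomZ : ℕ → ℤ → ℤ
binomZ n (+ j)     = + (n C j)
binomZ n -[1+ _ ]  = + 0

ballot : ℕ → ℕ → ℤ
ballot n k = binomZ (2 ℕ.* n) (+ n ℤ.- + k) ℤ.- binomZ (2 ℕ.* n) (+ n ℤ.- + k ℤ.- + 1)

{-# OPTIONS --safe #-}

-- Write S for the shift of sequences and X_j = ∏_{1≤i≤j} ((1 − q^i)² + q^i S).
-- The values (X_j a)_0, j ≥ 0, determine the sequence a, because X_j has leading
-- coefficient a power of q.  Both sides of the theorem, multiplied by 1 − q,
-- give (q;q)_j (q;q)_{j+1}:
--
-- * for the continued fraction, contract it to a J-fraction; applied to the first
--   basis vector, X_j of the tridiagonal operator has entries in closed product
--   form (continuous dual q-Hahn polynomials);
-- * for the ballot sum, S acts on the index k as multiplication by x + 2 + 1/x,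
--   with reflection Y_{−1−k} = −Y_k at the boundary, and (q − 1) X_j Y has the
--   form H_j(k) + H_j(k+1), where H_j solves a second order recurrence that the
--   factor X_{j+1}/X_j turns into the one for j + 1; at k = 0 this sum is explicit.
module Submission where

open import Algebra.Bundles using (CommutativeRing; RawRing)
open import Algebra.Solver.Ring.AlmostCommutativeRing using (fromCommutativeRing; _-Raw-AlmostCommutative⟶_)
import Algebra.Properties.AbelianGroup as AbelianGroupProperties
import Algebra.Properties.CommutativeSemigroup as CommutativeSemigroupProperties
import Algebra.Properties.Ring as RingProperties
import Algebra.Properties.Semiring.Mult.TCOptimised as Mult
import Algebra.Solver.Ring as RingSolver
open import Data.Integer as ℤ using (ℤ; +_; -[1+_])
import Data.Integer.Properties as ℤₚ
open import Data.Integer.Solver using (module +-*-Solver)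
open import Data.List using ([]; _∷_)
open import Data.Maybe using (Maybe; just; nothing)
open import Data.Nat as ℕ using (ℕ; zero; suc; z≤n; s≤s)
open import Data.Nat.Combinatorics using (_C_; nC1≡n; nCk≡nC[n∸k]; nCk+nC[k+1]≡[n+1]C[k+1])
import Data.Nat.Properties as ℕₚ
open import Data.Sum using (inj₁; inj₂)
open import Level using (0ℓ)
open import Relation.Binary.PropositionalEquality as ≡ using (_≡_; cong; cong₂)
open import Relation.Nullary using (yes; no)

-- Integer coefficients in a commutative ring, and a ring solver over them.

module IntegerCoefficients {c ℓ} (R : CommutativeRing c ℓ) where

  open CommutativeRing R
  open RingProperties ring using (-‿distribˡ-*; -‿distribʳ-*; -0#≈0#; -‿involutive)
  open AbelianGroupProperties +-abelianGroup using (⁻¹-∙-comm)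
  open Mult semiring using (_×_; 1+×; ×-homo-+; ×1-homo-*)
  open import Relation.Binary.Reasoning.Setoid setoid

  -- With the optimised multiples, `ι (+ 1)` computes to `1#` and `ι (+ 2)` to `1# + 1#`, so
  -- `con (+ 1)` and `con (+ 2)` match the constants in the goals.
  ι : ℤ → Carrier
  ι (+ n)    = n × 1#
  ι -[1+ n ] = - (suc n × 1#)

  ι-⊖ : ∀ m n → ι (m ℤ.⊖ n) ≈ m × 1# - n × 1#
  ι-⊖ zero    zero    = sym (-‿inverseʳ 0#)
  ι-⊖ zero    (suc n) = sym (+-identityˡ _)
  ι-⊖ (suc m) zero    = sym (trans (+-congˡ -0#≈0#) (+-identityʳ _))
  ι-⊖ (suc m) (suc n) = begin
    ι (suc m ℤ.⊖ suc n)                     ≡⟨ ≡.cong ι (ℤₚ.[1+m]⊖[1+n]≡m⊖n m n) ⟩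
    ι (m ℤ.⊖ n)                             ≈⟨ ι-⊖ m n ⟩
    m × 1# - n × 1#                         ≈⟨ +-congʳ (+-identityˡ _) ⟨
    0# + m × 1# - n × 1#                    ≈⟨ +-congʳ (+-congʳ (-‿inverseʳ 1#)) ⟨
    1# - 1# + m × 1# - n × 1#               ≈⟨ +-congʳ (+-assoc _ _ _) ⟩
    1# + (- 1# + m × 1#) - n × 1#           ≈⟨ +-congʳ (+-congˡ (+-comm _ _)) ⟩
    1# + (m × 1# - 1#) - n × 1#             ≈⟨ +-congʳ (+-assoc _ _ _) ⟨
    1# + m × 1# - 1# - n × 1#               ≈⟨ +-assoc _ _ _ ⟩
    1# + m × 1# + (- 1# - n × 1#)           ≈⟨ +-congˡ (⁻¹-∙-comm _ _) ⟩
    1# + m × 1# - (1# + n × 1#)             ≈⟨ +-cong (1+× m 1#) (-‿cong (1+× n 1#)) ⟨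
    suc m × 1# - suc n × 1#                 ∎

  ι-+ : ∀ i j → ι (i ℤ.+ j) ≈ ι i + ι j
  ι-+ (+ m)    (+ n)    = ×-homo-+ 1# m n
  ι-+ (+ m)    -[1+ n ] = ι-⊖ m (suc n)
  ι-+ -[1+ m ] (+ n)    = trans (ι-⊖ n (suc m)) (+-comm _ _)
  ι-+ -[1+ m ] -[1+ n ] = begin
    - (suc (suc (m ℕ.+ n)) × 1#)    ≡⟨ ≡.cong (λ k → - (suc k × 1#)) (ℕₚ.+-suc m n) ⟨
    - ((suc m ℕ.+ suc n) × 1#)      ≈⟨ -‿cong (×-homo-+ 1# (suc m) (suc n)) ⟩
    - (suc m × 1# + suc n × 1#)     ≈⟨ ⁻¹-∙-comm _ _ ⟨
    - (suc m × 1#) - suc n × 1#     ∎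

  ι-neg : ∀ i → ι (ℤ.- i) ≈ - ι i
  ι-neg (+ zero)  = sym -0#≈0#
  ι-neg (+ suc n) = refl
  ι-neg -[1+ n ]  = sym (-‿involutive _)

  ι-pos-* : ∀ m n → ι (+ m ℤ.* + n) ≈ ι (+ m) * ι (+ n)
  ι-pos-* m n = trans (reflexive (≡.cong ι (≡.sym (ℤₚ.pos-* m n)))) (×1-homo-* m n)

  ι-*-pos : ∀ i n → ι (i ℤ.* + n) ≈ ι i * ι (+ n)
  ι-*-pos (+ m)    n = ι-pos-* m n
  ι-*-pos -[1+ m ] n = begin
    ι (-[1+ m ] ℤ.* + n)        ≡⟨ ≡.cong ι (ℤₚ.neg-distribˡ-* (+ suc m) (+ n)) ⟨
    ι (ℤ.- (+ suc m ℤ.* + n))   ≈⟨ ι-neg (+ suc m ℤ.* + n) ⟩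
    - ι (+ suc m ℤ.* + n)       ≈⟨ -‿cong (ι-pos-* (suc m) n) ⟩
    - (ι (+ suc m) * ι (+ n))   ≈⟨ -‿distribˡ-* _ _ ⟩
    ι -[1+ m ] * ι (+ n)        ∎

  ι-* : ∀ i j → ι (i ℤ.* j) ≈ ι i * ι j
  ι-* i (+ n)    = ι-*-pos i n
  ι-* i -[1+ n ] = begin
    ι (i ℤ.* -[1+ n ])          ≡⟨ ≡.cong ι (ℤₚ.neg-distribʳ-* i (+ suc n)) ⟨
    ι (ℤ.- (i ℤ.* + suc n))     ≈⟨ ι-neg (i ℤ.* + suc n) ⟩
    - ι (i ℤ.* + suc n)         ≈⟨ -‿cong (ι-*-pos i (suc n)) ⟩
    - (ι i * ι (+ suc n))       ≈⟨ -‿distribʳ-* _ _ ⟩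
    ι i * ι -[1+ n ]            ∎

  ℤ-rawRing : RawRing 0ℓ 0ℓ
  ℤ-rawRing = CommutativeRing.rawRing ℤₚ.+-*-commutativeRing

  ι-homomorphism : ℤ-rawRing -Raw-AlmostCommutative⟶ fromCommutativeRing R
  ι-homomorphism = record
    { ⟦_⟧    = ι
    ; +-homo = ι-+
    ; *-homo = ι-*
    ; -‿homo = ι-neg
    ; 0-homo = refl
    ; 1-homo = refl
    }

  -- Equality in R need not be decidable, so the integers are compared before they are mapped;
  -- `nothing` asserts no inequality, as `ι` may fail to be injective.
  ι-≟ : ∀ i j → Maybe (ι i ≈ ι j)
  ι-≟ i j with i ℤₚ.≟ j
  ... | yes i≡j = just (reflexive (≡.cong ι i≡j))
  ... | no  _   = nothing

  open RingSolver ℤ-rawRing (fromCommutativeRing R) ι-homomorphism ι-≟ public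
    using (Polynomial; solve; _:=_; con; _:+_; _:*_; _:-_; :-_)

-- Finite sums and Cauchy products.

module Sums {c ℓ} (R : CommutativeRing c ℓ) where

  open CommutativeRing R hiding (zero)
  open IntegerCoefficients R
  open import Relation.Binary.Reasoning.Setoid setoid

  ∑ : ℕ → (ℕ → Carrier) → Carrier
  ∑ zero    f = 0#
  ∑ (suc n) f = ∑ n f + f n

  ∑-cong-< : ∀ n {f g} → (∀ i → i ℕ.< n → f i ≈ g i) → ∑ n f ≈ ∑ n g
  ∑-cong-< zero    f≈g = refl
  ∑-cong-< (suc n) f≈g = +-cong (∑-cong-< n (λ i i<n → f≈g i (ℕₚ.m<n⇒m<1+n i<n))) (f≈g n (ℕₚ.n<1+n n))

  ∑-head : ∀ n f → ∑ (suc n) f ≈ f 0 + ∑ n (λ i → f (suc i))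
  ∑-head zero    f = +-comm _ _
  ∑-head (suc n) f = trans (+-congʳ (∑-head n f)) (+-assoc _ _ _)

  *-∑ : ∀ n x f → ∑ n (λ i → x * f i) ≈ x * ∑ n f
  *-∑ zero    x f = sym (zeroʳ x)
  *-∑ (suc n) x f = trans (+-congʳ (*-∑ n x f)) (sym (distribˡ _ _ _))

  ∑-truncate : ∀ m n f → (∀ i → m ℕ.≤ i → f i ≈ 0#) → m ℕ.≤ n → ∑ n f ≈ ∑ m f
  ∑-truncate m n f f≈0 m≤n with ℕₚ.m≤n⇒m<n∨m≡n m≤n
  ... | inj₂ ≡.refl = refl
  ∑-truncate m (suc n) f f≈0 m≤n | inj₁ (s≤s m≤n′) =
    trans (+-cong (∑-truncate m n f f≈0 m≤n′) (f≈0 n m≤n′)) (+-identityʳ _)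

  -- The Cauchy product is unrolled along the left factor, which avoids truncated subtraction and
  -- allows structural recursion; `∑≈conv` links it to the usual sum.
  conv : (ℕ → Carrier) → (ℕ → Carrier) → ℕ → Carrier
  conv a b zero    = a 0 * b 0
  conv a b (suc n) = a 0 * b (suc n) + conv (λ i → a (suc i)) b n

  conv-congˡ : ∀ n {a a'} b → (∀ i → i ℕ.≤ n → a i ≈ a' i) → conv a b n ≈ conv a' b n
  conv-congˡ zero    b eq = *-congʳ (eq 0 z≤n)
  conv-congˡ (suc n) b eq = +-cong (*-congʳ (eq 0 z≤n)) (conv-congˡ n b (λ i i≤n → eq (suc i) (s≤s i≤n)))

  conv-congʳ : ∀ n a {b b'} → (∀ i → b i ≈ b' i) → conv a b n ≈ conv a b' n
  conv-congʳ zero    a eq = *-congˡ (eq 0)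
  conv-congʳ (suc n) a eq = +-cong (*-congˡ (eq (suc n))) (conv-congʳ n _ eq)

  conv-sucʳ : ∀ n a b → conv a b (suc n) ≈ a (suc n) * b 0 + conv a (λ i → b (suc i)) n
  conv-sucʳ zero    a b = +-comm _ _
  conv-sucʳ (suc n) a b = trans (+-congˡ (conv-sucʳ n _ b))
    (solve 3 (λ x y z → x :+ (y :+ z) := y :+ (x :+ z)) refl _ _ _)

  conv-comm : ∀ n a b → conv a b n ≈ conv b a n
  conv-comm zero    a b = *-comm _ _
  conv-comm (suc n) a b = trans (+-cong (*-comm _ _) (conv-comm n _ b)) (sym (conv-sucʳ n b a))

  conv-linearˡ : ∀ n x a b c → conv (λ i → x * a i + b i) c n ≈ x * conv a c n + conv b c n
  conv-linearˡ zero    x a b c = solve 4 (λ x a b c → (x :* a :+ b) :* c := x :* (a :* c) :+ b :* c) refl _ _ _ _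
  conv-linearˡ (suc n) x a b c = trans (+-congˡ (conv-linearˡ n x _ _ c))
    (solve 6 (λ x a b c r s → (x :* a :+ b) :* c :+ (x :* r :+ s) := x :* (a :* c :+ r) :+ (b :* c :+ s)) refl x _ _ _ _ _)

  conv-scaleʳ : ∀ n x a b → conv a (λ i → x * b i) n ≈ x * conv a b n
  conv-scaleʳ zero    x a b = solve 3 (λ x a b → a :* (x :* b) := x :* (a :* b)) refl _ _ _
  conv-scaleʳ (suc n) x a b = trans (+-congˡ (conv-scaleʳ n x _ b))
    (solve 4 (λ x a b r → a :* (x :* b) :+ x :* r := x :* (a :* b :+ r)) refl _ _ _ _)

  -- The shift of `conv a b` is `a 0` times the shift of `b`, plus `b` convolved with the shift of
  -- `a`. Linearity in the left factor then reduces the order by one.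
  conv-assoc : ∀ n a b c → conv (conv a b) c n ≈ conv a (conv b c) n
  conv-assoc zero    a b c = *-assoc _ _ _
  conv-assoc (suc n) a b c = begin
    a 0 * b 0 * c (suc n) + conv (λ i → a 0 * b (suc i) + conv (λ k → a (suc k)) b i) c n
      ≈⟨ +-congˡ (conv-linearˡ n (a 0) _ _ c) ⟩
    a 0 * b 0 * c (suc n) + (a 0 * conv (λ i → b (suc i)) c n + conv (conv (λ k → a (suc k)) b) c n)
      ≈⟨ +-congˡ (+-congˡ (conv-assoc n _ b c)) ⟩
    a 0 * b 0 * c (suc n) + (a 0 * conv (λ i → b (suc i)) c n + conv (λ k → a (suc k)) (conv b c) n)
      ≈⟨ solve 5 (λ a b c r s → a :* b :* c :+ (a :* r :+ s) := a :* (b :* c :+ r) :+ s) refl _ _ _ _ _ ⟩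
    a 0 * (b 0 * c (suc n) + conv (λ i → b (suc i)) c n) + conv (λ k → a (suc k)) (conv b c) n ∎

  conv-congʳ-≤ : ∀ n a {b b'} → (∀ i → i ℕ.≤ n → b i ≈ b' i) → conv a b n ≈ conv a b' n
  conv-congʳ-≤ n a {b} {b'} eq = trans (conv-comm n a b) (trans (conv-congˡ n a eq) (conv-comm n b' a))

  conv-zeroˡ : ∀ n a b → (∀ i → i ℕ.≤ n → a i ≈ 0#) → conv a b n ≈ 0#
  conv-zeroˡ zero    a b eq = trans (*-congʳ (eq 0 z≤n)) (zeroˡ _)
  conv-zeroˡ (suc n) a b eq = trans
    (+-cong (trans (*-congʳ (eq 0 z≤n)) (zeroˡ _)) (conv-zeroˡ n _ b (λ i i≤n → eq (suc i) (s≤s i≤n))))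
    (+-identityʳ _)

  conv-identityˡ : ∀ n a b → a 0 ≈ 1# → (∀ i → a (suc i) ≈ 0#) → conv a b n ≈ b n
  conv-identityˡ zero    a b a₀ a₊ = trans (*-congʳ a₀) (*-identityˡ _)
  conv-identityˡ (suc n) a b a₀ a₊ = trans
    (+-cong (trans (*-congʳ a₀) (*-identityˡ _)) (conv-zeroˡ n _ b (λ i _ → a₊ i)))
    (+-identityʳ _)

  conv-+ʳ : ∀ n a b c → conv a (λ i → b i + c i) n ≈ conv a b n + conv a c n
  conv-+ʳ zero    a b c = distribˡ _ _ _
  conv-+ʳ (suc n) a b c = trans (+-cong (distribˡ _ _ _) (conv-+ʳ n _ b c))
    (solve 4 (λ x y z w → x :+ y :+ (z :+ w) := x :+ z :+ (y :+ w)) refl _ _ _ _)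

  ∑-conv : ∀ M n a (b : ℕ → ℕ → Carrier) → ∑ M (λ k → conv a (b k) n) ≈ conv a (λ i → ∑ M (λ k → b k i)) n
  ∑-conv zero    n a b = sym (trans (conv-comm n a _) (conv-zeroˡ n _ a (λ _ _ → refl)))
  ∑-conv (suc M) n a b = trans (+-congʳ (∑-conv M n a b)) (sym (conv-+ʳ n a _ _))

  ∑≈conv : ∀ n a b → ∑ (suc n) (λ i → a i * b (n ℕ.∸ i)) ≈ conv a b n
  ∑≈conv zero    a b = +-identityˡ _
  ∑≈conv (suc n) a b = trans (∑-head (suc n) _) (+-congˡ (∑≈conv n (λ i → a (suc i)) b))

-- The operators X_j and their action on sequences.

module Moments {c ℓ} (R : CommutativeRing c ℓ) (q : CommutativeRing.Carrier R) where

  open CommutativeRing R hiding (zero)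
  open IntegerCoefficients R
  open Sums R
  open import Relation.Binary.Reasoning.Setoid setoid

  q^ : ℕ → Carrier
  q^ zero    = 1#
  q^ (suc m) = q * q^ m

  1-q^ : ℕ → Carrier
  1-q^ m = 1# - q^ m

  split : ∀ x → x ≈ (1# - q) * x + q * x
  split x = solve 2 (λ q x → x := (con (+ 1) :- q) :* x :+ q :* x) refl q x

  1-q^-suc : ∀ m x → (1# - q) * x ≈ 1-q^ m → (1# - q) * (1# + q * x) ≈ 1-q^ (suc m)
  1-q^-suc m x eq = begin
    (1# - q) * (1# + q * x)           ≈⟨ solve 2 (λ q x → (con (+ 1) :- q) :* (con (+ 1) :+ q :* x)
                                           := con (+ 1) :- q :+ q :* ((con (+ 1) :- q) :* x)) refl q x ⟩
    1# - q + q * ((1# - q) * x)       ≈⟨ +-congˡ (*-congˡ eq) ⟩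
    1# - q + q * (1# - q^ m)          ≈⟨ solve 2 (λ q Q → con (+ 1) :- q :+ q :* (con (+ 1) :- Q)
                                           := con (+ 1) :- q :* Q) refl q (q^ m) ⟩
    1-q^ (suc m)                         ∎

  square-* : ∀ s {x x' y y'} → s * x ≈ x' → s * y ≈ y' → s * s * (x * y) ≈ x' * y'
  square-* s {x} {x'} {y} {y'} ex ey = trans
    (solve 3 (λ s x y → s :* s :* (x :* y) := s :* x :* (s :* y)) refl s x y) (*-cong ex ey)

  regroup : ∀ x y z → x + (1# + 1#) * y + z ≈ (x + y) + (y + z)
  regroup = solve 3 (λ x y z → x :+ con (+ 2) :* y :+ z := (x :+ y) :+ (y :+ z)) refl

  -- κ j = (q;q)_j² and e j = (q;q)_j (q;q)_{j+1}.
  κ : ℕ → Carrier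
  κ zero    = 1#
  κ (suc j) = 1-q^ (suc j) * 1-q^ (suc j) * κ j

  e : ℕ → Carrier
  e j = 1-q^ (suc j) * κ j

  sign : ℕ → Carrier
  sign zero    = 1#
  sign (suc i) = - sign i

  -- Φ j a is X_j a.
  Φ : ℕ → (ℕ → Carrier) → ℕ → Carrier
  Φ zero    a n = a n
  Φ (suc j) a n = 1-q^ (suc j) * 1-q^ (suc j) * Φ j a n + q^ (suc j) * Φ j a (suc n)

  Φ-cong : ∀ j {a b} → (∀ n → a n ≈ b n) → ∀ n → Φ j a n ≈ Φ j b n
  Φ-cong zero    a≈b n = a≈b n
  Φ-cong (suc j) a≈b n = +-cong (*-congˡ (Φ-cong j a≈b n)) (*-congˡ (Φ-cong j a≈b (suc n)))

  Φ-shift : ∀ j a n → Φ j (λ i → a (suc i)) n ≈ Φ j a (suc n)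
  Φ-shift zero    a n = refl
  Φ-shift (suc j) a n = +-cong (*-congˡ (Φ-shift j a n)) (*-congˡ (Φ-shift j a (suc n)))

  Φ-linear : ∀ j x y z a b c n →
             Φ j (λ i → x * a i + y * b i + z * c i) n ≈ x * Φ j a n + y * Φ j b n + z * Φ j c n
  Φ-linear zero    x y z a b c n = refl
  Φ-linear (suc j) x y z a b c n =
    trans (+-cong (*-congˡ (Φ-linear j x y z a b c n)) (*-congˡ (Φ-linear j x y z a b c (suc n))))
      (solve 11 (λ r s x y z a b c a' b' c' →
        r :* (x :* a :+ y :* b :+ z :* c) :+ s :* (x :* a' :+ y :* b' :+ z :* c')
        := x :* (r :* a :+ s :* a') :+ y :* (r :* b :+ s :* b') :+ z :* (r :* c :+ s :* c'))
        refl _ _ x y z _ _ _ _ _ _)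

  -- X_j is a polynomial in the shift, hence linear and commuting with it, so a three-term rule for
  -- the shifted sequence passes through X_j.
  Φ-step : ∀ j x y z a b c d → (∀ n → a (suc n) ≈ x * b n + y * c n + z * d n) → ∀ n →
           Φ j a (suc n) ≈ x * Φ j b n + y * Φ j c n + z * Φ j d n
  Φ-step j x y z a b c d eq n =
    trans (sym (Φ-shift j a n)) (trans (Φ-cong j eq n) (Φ-linear j x y z b c d n))

  -- The sequences H_j and the reflected orbit.

  -- With P the full-line solution of P_m = q^m P_{m−1} + (−1)^m (2m+1), H j i is
  -- the value of X_j P at i − 1 plus its value at i.
  H : ℕ → ℕ → Carrier
  H j zero          = κ j
  H j (suc zero)    = - (κ j + e j)
  H j (suc (suc i)) = q^ (suc j) * (q^ (suc i) - 1#) * H j (suc i) + q^ (suc i) * H j i + (1# + 1#) * e j * sign i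

  private
    :1 : ∀ {n} → Polynomial n
    :1 = con (+ 1)
    :2 : ∀ {n} → Polynomial n
    :2 = con (+ 2)

    :H : ∀ {n} (a Q h1 h0 e s : Polynomial n) → Polynomial n
    :H a Q h1 h0 e s = a :* (Q :- :1) :* h1 :+ Q :* h0 :+ :2 :* e :* s

    :step : ∀ {n} (a h0 h1 h2 : Polynomial n) → Polynomial n
    :step a h0 h1 h2 = (:1 :+ a :* a) :* h1 :+ a :* (h0 :+ h2)

  -- With a = q^(j+1), the factor X_{j+1}/X_j becomes (1 - a)² + a(x + 2 + 1/x) = 1 + a² + a(x +
  -- 1/x) acting on the index.
  step : ∀ j i → Carrier
  step j i = (1# + q^ (suc j) * q^ (suc j)) * H j (suc i) + q^ (suc j) * (H j i + H j (suc (suc i)))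

  -- `step j` satisfies the recurrence of `H (suc j)`. The initial value `H (suc j) 0` is not a
  -- value of `step`, so two induction hypotheses can be used only from the third case on.
  H-step : ∀ j i → H (suc j) (suc i) ≈ step j i
  H-step j zero =
    solve 3 (λ a q κ → let e = (:1 :- a) :* κ ; κ' = (:1 :- a) :* (:1 :- a) :* κ
                           h1 = :- (κ :+ e) in
      :- (κ' :+ (:1 :- q :* a) :* κ') := :step a κ h1 (:H a (q :* :1) h1 κ e :1)) refl (q^ (suc j)) q (κ j)
  H-step j (suc zero) = trans
    (+-congʳ (+-congʳ (*-congˡ (H-step j zero))))
    (solve 3 (λ a q κ → let e = (:1 :- a) :* κ ; κ' = (:1 :- a) :* (:1 :- a) :* κ
                            h1 = :- (κ :+ e) ; h2 = :H a (q :* :1) h1 κ e :1 in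
      :H (q :* a) (q :* :1) (:step a κ h1 h2) κ' ((:1 :- q :* a) :* κ') :1
      := :step a h1 h2 (:H a (q :* (q :* :1)) h2 h1 e (:- :1))) refl (q^ (suc j)) q (κ j))
  H-step j (suc (suc i)) = trans
    (+-congʳ (+-cong (*-congˡ (H-step j (suc i))) (*-congˡ (H-step j i))))
    (solve 7 (λ a q Q κ s h0 h1 → let e = (:1 :- a) :* κ ; κ' = (:1 :- a) :* (:1 :- a) :* κ
                                      h2 = :H a Q h1 h0 e s
                                      h3 = :H a (q :* Q) h2 h1 e (:- s) in
      :H (q :* a) (q :* Q) (:step a h1 h2 h3) (:step a h0 h1 h2) ((:1 :- q :* a) :* κ') (:- s)
      := :step a h2 h3 (:H a (q :* (q :* Q)) h3 h2 e (:- (:- s)))) refl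
      (q^ (suc j)) q (q^ (suc i)) (κ j) (sign i) (H j i) (H j (suc i)))

  -- orbit η m n is the m-th entry of the n-th iterate of x + 2 + 1/x on the
  -- sequence η, extended by η_{−1} = −η_0.
  orbit : (ℕ → Carrier) → ℕ → ℕ → Carrier
  orbit η m       zero    = η m
  orbit η zero    (suc n) = orbit η zero n + orbit η (suc zero) n
  orbit η (suc m) (suc n) = orbit η m n + (1# + 1#) * orbit η (suc m) n + orbit η (suc (suc m)) n

  -- The shift acts on `orbit η m` as x + 2 + 1/x in m, so each new factor of X_j turns the two
  -- neighbouring values of `H j` into values of `step`, which `H-step` identifies.
  Φ-orbit : ∀ η → (∀ m → η m ≈ H 0 m + H 0 (suc m)) → ∀ j m → Φ j (orbit η m) 0 ≈ H j m + H j (suc m)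
  Φ-orbit η η≈ zero    m       = η≈ m
  Φ-orbit η η≈ (suc j) zero    = begin
    P * Φ j (orbit η 0) 0 + a * Φ j (orbit η 0) 1
      -- The boundary rule has two terms and `Φ-step` takes three; the third one gets coefficient
      -- zero.
      ≈⟨ +-congˡ (*-congˡ (Φ-step j 1# 1# 0# (orbit η 0) (orbit η 0) (orbit η 1) (orbit η 1)
           (λ n → solve 2 (λ u v → u :+ v := :1 :* u :+ :1 :* v :+ con (+ 0) :* v) refl _ _) 0)) ⟩
    P * Φ j (orbit η 0) 0 + a * (1# * Φ j (orbit η 0) 0 + 1# * Φ j (orbit η 1) 0 + 0# * Φ j (orbit η 1) 0)
      ≈⟨ solve 4 (λ P a u v → P :* u :+ a :* (:1 :* u :+ :1 :* v :+ con (+ 0) :* v) := P :* u :+ a :* (u :+ v)) refl _ _ _ _ ⟩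
    P * Φ j (orbit η 0) 0 + a * (Φ j (orbit η 0) 0 + Φ j (orbit η 1) 0)
      ≈⟨ +-cong (*-congˡ (Φ-orbit η η≈ j 0)) (*-congˡ (+-cong (Φ-orbit η η≈ j 0) (Φ-orbit η η≈ j 1))) ⟩
    P * (H j 0 + H j 1) + a * ((H j 0 + H j 1) + (H j 1 + H j 2))
      ≈⟨ solve 4 (λ a h0 h1 h2 → let P = (:1 :- a) :* (:1 :- a) in
           P :* (h0 :+ h1) :+ a :* ((h0 :+ h1) :+ (h1 :+ h2)) := P :* h0 :+ :step a h0 h1 h2)
           refl a (H j 0) (H j 1) (H j 2) ⟩
    P * H j 0 + step j 0
      -- `P * H j 0` is `κ (suc j)` by definition: the remainder left by the reflection is exactly
      -- the initial value of `H (suc j)`.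
      ≈⟨ +-congˡ (H-step j 0) ⟨
    H (suc j) 0 + H (suc j) 1 ∎
    where a = q^ (suc j)
          P = 1-q^ (suc j) * 1-q^ (suc j)
  Φ-orbit η η≈ (suc j) (suc m) = begin
    P * Φ j (orbit η (suc m)) 0 + a * Φ j (orbit η (suc m)) 1
      ≈⟨ +-congˡ (*-congˡ (Φ-step j 1# (1# + 1#) 1# (orbit η (suc m)) (orbit η m) (orbit η (suc m)) (orbit η (suc (suc m)))
           (λ n → solve 3 (λ u v w → u :+ :2 :* v :+ w := :1 :* u :+ :2 :* v :+ :1 :* w) refl _ _ _) 0)) ⟩
    P * Φ j (orbit η (suc m)) 0 + a * (1# * Φ j (orbit η m) 0 + (1# + 1#) * Φ j (orbit η (suc m)) 0 + 1# * Φ j (orbit η (suc (suc m))) 0)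
      ≈⟨ +-cong (*-congˡ (Φ-orbit η η≈ j (suc m)))
           (*-congˡ (+-cong (+-cong (*-congˡ (Φ-orbit η η≈ j m)) (*-congˡ (Φ-orbit η η≈ j (suc m)))) (*-congˡ (Φ-orbit η η≈ j (suc (suc m)))))) ⟩
    P * (h1 + h2) + a * (1# * (h0 + h1) + (1# + 1#) * (h1 + h2) + 1# * (h2 + h3))
      ≈⟨ solve 5 (λ a h0 h1 h2 h3 → let P = (:1 :- a) :* (:1 :- a) in
           P :* (h1 :+ h2) :+ a :* (:1 :* (h0 :+ h1) :+ :2 :* (h1 :+ h2) :+ :1 :* (h2 :+ h3))
           := :step a h0 h1 h2 :+ :step a h1 h2 h3) refl a h0 h1 h2 h3 ⟩
    step j m + step j (suc m)
      ≈⟨ +-cong (H-step j m) (H-step j (suc m)) ⟨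
    H (suc j) (suc m) + H (suc j) (suc (suc m)) ∎
    where a = q^ (suc j)
          P = 1-q^ (suc j) * 1-q^ (suc j)
          h0 = H j m
          h1 = H j (suc m)
          h2 = H j (suc (suc m))
          h3 = H j (suc (suc (suc m)))

  -- The initial values of `H j` cancel up to `- e j`, the opposite of the value in `Φ-A-zero`; this
  -- is why the two sequences are later compared through their sum.
  Φ-orbit-zero : ∀ η → (∀ m → η m ≈ H 0 m + H 0 (suc m)) → ∀ j → Φ j (orbit η 0) 0 ≈ - e j
  Φ-orbit-zero η η≈ j = trans (Φ-orbit η η≈ j 0) (solve 2 (λ k e → k :+ :- (k :+ e) := :- e) refl (κ j) (e j))

  -- Summation by parts and the ballot sum.

  record Reflected (f g : ℕ → Carrier) : Set ℓ where
    field
      at-zero : g 0 ≈ f 0 + f 1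
      at-suc  : ∀ k → g (suc k) ≈ f k + (1# + 1#) * f (suc k) + f (suc (suc k))
  open Reflected

  -- The reflected operator has a symmetric matrix, with diagonal 1, 2, 2, ... and neighbouring
  -- entries 1. Moving it across a sum cut off at M leaves only the two products that link M with M
  -- + 1.
  ∑-by-parts : ∀ {f f' g g'} → Reflected f f' → Reflected g g' → ∀ M →
    ∑ (suc M) (λ k → f' k * g k) + f M * g (suc M) ≈ ∑ (suc M) (λ k → f k * g' k) + f (suc M) * g M
  ∑-by-parts {f} {f'} {g} {g'} F G zero =
    trans (+-congʳ (+-congˡ (*-congʳ (at-zero F))))
      (trans (solve 4 (λ f0 f1 g0 g1 → con (+ 0) :+ (f0 :+ f1) :* g0 :+ f0 :* g1 := con (+ 0) :+ f0 :* (g0 :+ g1) :+ f1 :* g0) refl _ _ _ _)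
        (sym (+-congʳ (+-congˡ (*-congˡ (at-zero G))))))
  ∑-by-parts {f} {f'} {g} {g'} F G (suc M) = begin
    s + f' (suc M) * g1 + f1 * g2
      ≈⟨ +-congʳ (+-congˡ (*-congʳ (at-suc F M))) ⟩
    s + (f0 + (1# + 1#) * f1 + f2) * g1 + f1 * g2
      ≈⟨ solve 6 (λ s f0 f1 f2 g1 g2 → s :+ (f0 :+ :2 :* f1 :+ f2) :* g1 :+ f1 :* g2
           := (s :+ f0 :* g1) :+ (:2 :* f1 :+ f2) :* g1 :+ f1 :* g2) refl s f0 f1 f2 g1 g2 ⟩
    (s + f0 * g1) + ((1# + 1#) * f1 + f2) * g1 + f1 * g2
      ≈⟨ +-congʳ (+-congʳ (∑-by-parts F G M)) ⟩
    (t + f1 * g0) + ((1# + 1#) * f1 + f2) * g1 + f1 * g2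
      ≈⟨ solve 6 (λ t f1 f2 g0 g1 g2 → (t :+ f1 :* g0) :+ (:2 :* f1 :+ f2) :* g1 :+ f1 :* g2
           := t :+ f1 :* (g0 :+ :2 :* g1 :+ g2) :+ f2 :* g1) refl t f1 f2 g0 g1 g2 ⟩
    t + f1 * (g0 + (1# + 1#) * g1 + g2) + f2 * g1
      ≈⟨ +-congʳ (+-congˡ (*-congˡ (at-suc G M))) ⟨
    t + f1 * g' (suc M) + f2 * g1 ∎
    where
    s = ∑ (suc M) (λ k → f' k * g k)
    t = ∑ (suc M) (λ k → f k * g' k)
    f0 = f M
    f1 = f (suc M)
    f2 = f (suc (suc M))
    g0 = g M
    g1 = g (suc M)
    g2 = g (suc (suc M))

  -- `β n` is the unit vector at 0 moved n times by the symmetric operator, and each move can be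
  -- transferred to `orbit`. The free i absorbs the transferred moves; the boundary terms vanish
  -- because `β n` does so beyond n.
  ∑-ballot : ∀ (β : ℕ → ℕ → Carrier) → β 0 0 ≈ 1# → (∀ n → Reflected (β n) (β (suc n))) →
             (∀ n k → n ℕ.< k → β n k ≈ 0#) → ∀ η n i →
             ∑ (suc n) (λ k → β n k * orbit η k i) ≈ orbit η 0 (n ℕ.+ i)
  ∑-ballot β β₀ βᵣ β> η zero    i =
    trans (+-identityˡ _) (trans (*-congʳ β₀) (*-identityˡ _))
  ∑-ballot β β₀ βᵣ β> η (suc n) i = begin
    ∑ (suc (suc n)) (λ k → β (suc n) k * orbit η k i)
      ≈⟨ +-identityʳ _ ⟨
    ∑ (suc (suc n)) (λ k → β (suc n) k * orbit η k i) + 0#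
      ≈⟨ +-congˡ (zero-* (n<1+n n)) ⟨
    ∑ (suc (suc n)) (λ k → β (suc n) k * orbit η k i) + β n (suc n) * orbit η (suc (suc n)) i
      ≈⟨ ∑-by-parts (βᵣ n) (record { at-zero = refl ; at-suc = λ k → refl }) (suc n) ⟩
    ∑ (suc n) (λ k → β n k * orbit η k (suc i)) + β n (suc n) * orbit η (suc n) (suc i) + β n (suc (suc n)) * orbit η (suc n) i
      ≈⟨ +-cong (+-congˡ (zero-* (n<1+n n))) (zero-* (m<n⇒m<1+n (n<1+n n))) ⟩
    ∑ (suc n) (λ k → β n k * orbit η k (suc i)) + 0# + 0#
      ≈⟨ trans (+-identityʳ _) (+-identityʳ _) ⟩
    ∑ (suc n) (λ k → β n k * orbit η k (suc i))
      ≈⟨ ∑-ballot β β₀ βᵣ β> η n (suc i) ⟩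
    orbit η 0 (n ℕ.+ suc i)
      ≡⟨ ≡.cong (orbit η 0) (ℕₚ.+-suc n i) ⟩
    orbit η 0 (suc n ℕ.+ i) ∎
    where
    open ℕₚ using (n<1+n; m<n⇒m<1+n)
    zero-* : ∀ {k x} → n ℕ.< k → β n k * x ≈ 0#
    zero-* n<k = trans (*-congʳ (β> n _ n<k)) (zeroˡ _)

  -- Moments of the tridiagonal operator.

  -- Weighted Motzkin paths of length n from height 0 to height m, for the J-fraction
  -- obtained by contracting the S-fraction with coefficients (1 − q)² λ_i.  The
  -- up-weights are chosen so that no denominators occur in Φ-A.
  A : ℕ → ℕ → Carrier
  A zero    zero    = 1-q^ 1
  A (suc m) zero    = 0#
  A zero    (suc n) = 1-q^ 1 * 1-q^ 1 * A 0 n + 1-q^ 1 * A 1 n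
  A (suc m) (suc n) = 1-q^ (suc m) * 1-q^ (suc m) * 1-q^ (suc (suc m)) * A m n
                      + (1-q^ (suc m) * 1-q^ (suc (suc m)) + 1-q^ (suc (suc m)) * 1-q^ (suc (suc m))) * A (suc m) n
                      + 1-q^ (suc (suc m)) * A (suc (suc m)) n

  -- `v j m` is the product of q(q^i - q^j) over 0 ≤ i < m. It is zero for m > j, as it must be for
  -- a polynomial of degree j in a tridiagonal operator.
  v : ℕ → ℕ → Carrier
  v j zero    = 1#
  v j (suc m) = v j m * (q * (q^ m - q^ j))

  -- Split off the factor with i = 0 and take one more q out of each of the m others.
  v-suc-suc : ∀ j m → v (suc j) (suc m) ≈ q^ (suc m) * 1-q^ (suc j) * v j m
  v-suc-suc j zero    = solve 2 (λ q J → :1 :* (q :* (:1 :- q :* J)) := q :* :1 :* (:1 :- q :* J) :* :1) refl q (q^ j)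
  v-suc-suc j (suc m) = trans (*-congʳ (v-suc-suc j m))
    (solve 4 (λ q Q J v → q :* Q :* (:1 :- q :* J) :* v :* (q :* (q :* Q :- q :* J))
       := q :* (q :* Q) :* (:1 :- q :* J) :* (v :* (q :* (Q :- J)))) refl q (q^ m) (q^ j) (v j m))

  v-zero : ∀ m → v 0 (suc m) ≈ 0#
  v-zero zero    = solve 1 (λ q → :1 :* (q :* (:1 :- :1)) := con (+ 0)) refl q
  v-zero (suc m) = trans (*-congʳ (v-zero m)) (zeroˡ _)

  -- Induction on j for all m at once: the recurrence of `A` in the path length expresses the new
  -- factor through the entries at the neighbouring heights. At height `suc m` all of these are
  -- multiples of `v j m`, and a polynomial identity in q, q^j and q^m remains.
  Φ-A : ∀ j m → Φ j (A m) 0 ≈ v j m * e j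
  Φ-A zero    zero    = solve 1 (λ q → :1 :- q :* :1 := :1 :* ((:1 :- q :* :1) :* :1)) refl q
  Φ-A zero    (suc m) = sym (trans (*-congʳ (v-zero m)) (zeroˡ _))
  Φ-A (suc j) zero    = begin
    1-q^ (suc j) * 1-q^ (suc j) * Φ j (A 0) 0 + q^ (suc j) * Φ j (A 0) 1
      ≈⟨ +-congˡ (*-congˡ (Φ-step j 0# (1-q^ 1 * 1-q^ 1) (1-q^ 1) (A 0) (A 0) (A 0) (A 1)
           (λ n → solve 3 (λ x a b → x :* x :* a :+ x :* b := con (+ 0) :* a :+ x :* x :* a :+ x :* b) refl _ _ _) 0)) ⟩
    1-q^ (suc j) * 1-q^ (suc j) * Φ j (A 0) 0 + q^ (suc j) * (0# * Φ j (A 0) 0 + 1-q^ 1 * 1-q^ 1 * Φ j (A 0) 0 + 1-q^ 1 * Φ j (A 1) 0)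
      ≈⟨ +-cong (*-congˡ (Φ-A j 0)) (*-congˡ (+-cong (+-cong (*-congˡ (Φ-A j 0)) (*-congˡ (Φ-A j 0))) (*-congˡ (Φ-A j 1)))) ⟩
    1-q^ (suc j) * 1-q^ (suc j) * (v j 0 * e j) + q^ (suc j) * (0# * (v j 0 * e j) + 1-q^ 1 * 1-q^ 1 * (v j 0 * e j) + 1-q^ 1 * (v j 1 * e j))
      ≈⟨ solve 3 (λ q J κ → let a = q :* J ; p' = :1 :- a ; p1 = :1 :- q :* :1
                                e = p' :* κ ; v0 = :1 ; v1 = :1 :* (q :* (:1 :- J)) in
           p' :* p' :* (v0 :* e) :+ a :* (con (+ 0) :* (v0 :* e) :+ p1 :* p1 :* (v0 :* e) :+ p1 :* (v1 :* e))
           := :1 :* ((:1 :- q :* a) :* (p' :* p' :* κ))) refl q (q^ j) (κ j) ⟩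
    v (suc j) 0 * e (suc j) ∎
  Φ-A (suc j) (suc m) = begin
    1-q^ (suc j) * 1-q^ (suc j) * Φ j (A (suc m)) 0 + q^ (suc j) * Φ j (A (suc m)) 1
      ≈⟨ +-congˡ (*-congˡ (Φ-step j c₀ c₁ c₂ (A (suc m)) (A m) (A (suc m)) (A (suc (suc m))) (λ n → refl) 0)) ⟩
    1-q^ (suc j) * 1-q^ (suc j) * Φ j (A (suc m)) 0 + q^ (suc j) * (c₀ * Φ j (A m) 0 + c₁ * Φ j (A (suc m)) 0 + c₂ * Φ j (A (suc (suc m))) 0)
      ≈⟨ +-cong (*-congˡ (Φ-A j (suc m))) (*-congˡ (+-cong (+-cong (*-congˡ (Φ-A j m)) (*-congˡ (Φ-A j (suc m)))) (*-congˡ (Φ-A j (suc (suc m)))))) ⟩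
    1-q^ (suc j) * 1-q^ (suc j) * (v j (suc m) * e j) + q^ (suc j) * (c₀ * (v j m * e j) + c₁ * (v j (suc m) * e j) + c₂ * (v j (suc (suc m)) * e j))
      ≈⟨ solve 5 (λ q J Q κ v → let a = q :* J ; p' = :1 :- a ; e = p' :* κ
                                    p1 = :1 :- q :* Q ; p2 = :1 :- q :* (q :* Q)
                                    v1 = v :* (q :* (Q :- J)) ; v2 = v1 :* (q :* (q :* Q :- J)) in
           p' :* p' :* (v1 :* e) :+ a :* (p1 :* p1 :* p2 :* (v :* e) :+ (p1 :* p2 :+ p2 :* p2) :* (v1 :* e) :+ p2 :* (v2 :* e))
           := q :* Q :* p' :* v :* ((:1 :- q :* a) :* (p' :* p' :* κ))) refl q (q^ j) (q^ m) (κ j) (v j m) ⟩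
    q^ (suc m) * 1-q^ (suc j) * v j m * e (suc j)
      ≈⟨ *-congʳ (v-suc-suc j m) ⟨
    v (suc j) (suc m) * e (suc j) ∎
    where
    c₀ = 1-q^ (suc m) * 1-q^ (suc m) * 1-q^ (suc (suc m))
    c₁ = 1-q^ (suc m) * 1-q^ (suc (suc m)) + 1-q^ (suc (suc m)) * 1-q^ (suc (suc m))
    c₂ = 1-q^ (suc (suc m))

  Φ-A-zero : ∀ j → Φ j (A 0) 0 ≈ e j
  Φ-A-zero j = trans (Φ-A j 0) (*-identityˡ _)

  -- Recovering a sequence from its values under all X_j.

  lead : ℕ → Carrier
  lead zero    = 1#
  lead (suc j) = q^ (suc j) * lead j

  -- Only the top power of the shift reaches index n + j; its coefficient in X_j is q^(1 + 2 + ... +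
  -- j), which is `lead j`.
  Φ-lead : ∀ j n δ → (∀ i → i ℕ.< n ℕ.+ j → δ i ≈ 0#) → Φ j δ n ≈ lead j * δ (n ℕ.+ j)
  Φ-lead zero    n δ δ≈0 = sym (trans (*-identityˡ _) (reflexive (≡.cong δ (ℕₚ.+-identityʳ n))))
  Φ-lead (suc j) n δ δ≈0 = begin
    1-q^ (suc j) * 1-q^ (suc j) * Φ j δ n + q^ (suc j) * Φ j δ (suc n)
      ≈⟨ +-cong (*-congˡ (trans (Φ-lead j n δ (λ i i< → δ≈0 i (ℕₚ.<-trans i< n+j<)))
                            (trans (*-congˡ (δ≈0 _ n+j<)) (zeroʳ _))))
                (*-congˡ (Φ-lead j (suc n) δ (λ i i< → δ≈0 i (≡.subst (i ℕ.<_) (≡.sym (ℕₚ.+-suc n j)) i<)))) ⟩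
    1-q^ (suc j) * 1-q^ (suc j) * 0# + q^ (suc j) * (lead j * δ (suc n ℕ.+ j))
      ≈⟨ +-cong (zeroʳ _) (sym (*-assoc _ _ _)) ⟩
    0# + lead (suc j) * δ (suc n ℕ.+ j)
      ≈⟨ +-identityˡ _ ⟩
    lead (suc j) * δ (suc n ℕ.+ j)
      ≡⟨ ≡.cong (λ k → lead (suc j) * δ k) (ℕₚ.+-suc n j) ⟨
    lead (suc j) * δ (n ℕ.+ suc j) ∎
    where
    n+j< : n ℕ.+ j ℕ.< n ℕ.+ suc j
    n+j< = ℕₚ.+-monoʳ-< n (ℕₚ.n<1+n j)

  module _ (q-cancel : ∀ x → q * x ≈ 0# → x ≈ 0#) where

    q^-cancel : ∀ m x → q^ m * x ≈ 0# → x ≈ 0#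
    q^-cancel zero    x eq = trans (sym (*-identityˡ x)) eq
    q^-cancel (suc m) x eq = q^-cancel m x (q-cancel _ (trans (sym (*-assoc _ _ _)) eq))

    lead-cancel : ∀ j x → lead j * x ≈ 0# → x ≈ 0#
    lead-cancel zero    x eq = trans (sym (*-identityˡ x)) eq
    lead-cancel (suc j) x eq = lead-cancel j x (q^-cancel (suc j) _ (trans (sym (*-assoc _ _ _)) eq))

    -- Strong induction with N as the bound: once δ vanishes below i, the value under X_i is
    -- `lead i * δ i`, and the power of q cancels.
    Φ-vanishing : ∀ δ → (∀ j → Φ j δ 0 ≈ 0#) → ∀ N i → i ℕ.< N → δ i ≈ 0#
    Φ-vanishing δ Φδ≈0 (suc N) i i<1+N =
      lead-cancel i _ (trans (sym (Φ-lead i 0 δ below)) (Φδ≈0 i))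
      where
      below : ∀ k → k ℕ.< i → δ k ≈ 0#
      below k k<i = Φ-vanishing δ Φδ≈0 N k (ℕₚ.<-≤-trans k<i (ℕ.s≤s⁻¹ i<1+N))

    Φ-injective : ∀ a b → (∀ j → Φ j a 0 + Φ j b 0 ≈ 0#) → ∀ n → a n + b n ≈ 0#
    Φ-injective a b eq n = trans
      (solve 2 (λ a b → a :+ b := :1 :* a :+ :1 :* b :+ con (+ 0) :* b) refl (a n) (b n))
      (Φ-vanishing (λ i → 1# * a i + 1# * b i + 0# * b i)
        (λ j → trans (Φ-linear j 1# 1# 0# a b b 0)
          (trans (solve 2 (λ a b → :1 :* a :+ :1 :* b :+ con (+ 0) :* b := a :+ b) refl _ _) (eq j)))
        (suc n) n (ℕₚ.n<1+n n))

  -- Products of continued fractions and contraction to a J-fraction.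

  module ContinuedFraction (λ' : ℕ → Carrier) where

    -- B (suc h) is the product of the continued fractions starting at the
    -- levels 0, …, h; the index of λ' is shifted: λ' h = λ_{h+1}.
    B : ℕ → ℕ → Carrier
    B zero    zero    = 1#
    B zero    (suc n) = 0#
    B (suc h) zero    = 1#
    B (suc h) (suc n) = B h (suc n) + λ' h * B (suc (suc h)) n

    B-head : ∀ h → B h 0 ≈ 1#
    B-head zero    = refl
    B-head (suc h) = refl

    module _ (f : ℕ → ℕ → ℕ → Carrier) (f-zero : ∀ d h → f d h 0 ≈ 1#)
      (f-suc : ∀ d h n → f (suc d) h (suc n) ≈ λ' h * conv (f d (suc h)) (f (suc d) h) n) where

      -- The fraction at level h satisfies F_h = 1 + λ' h z F_h F_{h+1}; multiplied by the product
      -- of the earlier ones, this is the recurrence of `B`. Order and depth drop together on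
      -- passing to the next level, so depth d is exact up to order d. N bounds the recursion, which
      -- also visits all smaller orders at level h.
      conv-B : ∀ N n h d → n ℕ.≤ N → n ℕ.≤ d → conv (B h) (f d h) n ≈ B (suc h) n
      conv-B N zero h d _ _ = trans (*-cong (B-head h) (f-zero d h)) (*-identityˡ _)
      conv-B (suc N) (suc n) h (suc d) (s≤s n≤N) (s≤s n≤d) = begin
        conv (B h) F (suc n)
          ≈⟨ conv-sucʳ n (B h) F ⟩
        B h (suc n) * F 0 + conv (B h) (λ i → F (suc i)) n
          ≈⟨ +-cong (trans (*-congˡ (f-zero (suc d) h)) (*-identityʳ _)) tail ⟩
        B h (suc n) + λ' h * B (suc (suc h)) n ∎
        where
        F = f (suc d) h
        G = f d (suc h)
        tail : conv (B h) (λ i → F (suc i)) n ≈ λ' h * B (suc (suc h)) n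
        tail = begin
          conv (B h) (λ i → F (suc i)) n           ≈⟨ conv-congʳ n (B h) (f-suc d h) ⟩
          conv (B h) (λ i → λ' h * conv G F i) n   ≈⟨ conv-scaleʳ n (λ' h) (B h) _ ⟩
          λ' h * conv (B h) (conv G F) n           ≈⟨ *-congˡ (conv-congʳ n (B h) (λ i → conv-comm i G F)) ⟩
          λ' h * conv (B h) (conv F G) n           ≈⟨ *-congˡ (conv-assoc n (B h) F G) ⟨
          λ' h * conv (conv (B h) F) G n           ≈⟨ *-congˡ (conv-congˡ n G (λ i i≤n →
                                                        conv-B N i h (suc d) (ℕₚ.≤-trans i≤n n≤N)
                                                          (ℕₚ.m≤n⇒m≤1+n (ℕₚ.≤-trans i≤n n≤d)))) ⟩
          λ' h * conv (B (suc h)) G n              ≈⟨ *-congˡ (conv-B N n (suc h) d n≤N n≤d) ⟩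
          λ' h * B (suc (suc h)) n                 ∎

      f≈B : ∀ n d → n ℕ.≤ d → f d 0 n ≈ B 1 n
      f≈B n d n≤d = trans (sym (conv-identityˡ n (B 0) (f d 0) refl (λ _ → refl))) (conv-B n n 0 d ℕₚ.≤-refl n≤d)

    -- Parity refers to the shifted index of `λ'`. In the form `m * 2` the index gains two
    -- successors by computation when m grows, so `B` unfolds twice by definition.
    module Contraction (s : Carrier)
      (λ-even : ∀ m → s * λ' (m ℕ.* 2) ≈ 1-q^ (suc m) * 1-q^ (suc m))
      (λ-odd  : ∀ m → s * λ' (suc (m ℕ.* 2)) ≈ 1-q^ (suc m) * 1-q^ (suc (suc m))) where

      s^ : ℕ → Carrier
      s^ zero    = 1#
      s^ (suc n) = s * s^ n

      σ : ℕ → Carrier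
      σ zero    = 1-q^ 1
      σ (suc m) = 1-q^ (suc m) * 1-q^ (suc m) * 1-q^ (suc (suc m)) * σ m

      A-above : ∀ m n → n ℕ.< m → A m n ≈ 0#
      A-above (suc m) zero    _         = refl
      A-above (suc m) (suc n) (s≤s n<m) = begin
        _ * A m n + _ * A (suc m) n + _ * A (suc (suc m)) n
          ≈⟨ +-cong (+-cong (*-congˡ (A-above m n n<m)) (*-congˡ (A-above (suc m) n n<1+m)))
                    (*-congˡ (A-above (suc (suc m)) n (ℕₚ.m<n⇒m<1+n n<1+m))) ⟩
        _ * 0# + _ * 0# + _ * 0#
          ≈⟨ solve 3 (λ x y z → x :* con (+ 0) :+ y :* con (+ 0) :+ z :* con (+ 0) := con (+ 0)) refl _ _ _ ⟩
        0# ∎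
        where n<1+m = ℕₚ.m<n⇒m<1+n n<m

      -- Dyck-type paths ending at height 2m are counted by the product of the fractions at levels
      -- 0, ..., 2m; contracted, they are Motzkin paths ending at height m. `σ m` collects the
      -- up-weights and the initial 1 - q. `A≈B′` is the companion for height 2m + 1, and `A≈B`
      -- calls it only at lower order.
      A≈B  : ∀ n m → A m (n ℕ.+ m) ≈ σ m * (s^ n * B (suc (m ℕ.* 2)) n)
      A≈B′ : ∀ n m → 1-q^ (suc m) * A (suc m) (n ℕ.+ m) + 1-q^ (suc m) * 1-q^ (suc m) * A m (n ℕ.+ m)
                     ≈ 1-q^ (suc m) * 1-q^ (suc m) * σ m * (s^ n * B (suc (suc (m ℕ.* 2))) n)

      A≈B zero    zero    = solve 1 (λ x → x := x :* (:1 :* :1)) refl _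
      A≈B zero    (suc m) = begin
        c₀ * A m m + _ * A (suc m) m + _ * A (suc (suc m)) m
          ≈⟨ +-cong (+-cong (*-congˡ (A≈B 0 m)) (*-congˡ (A-above (suc m) m (ℕₚ.n<1+n m))))
                    (*-congˡ (A-above (suc (suc m)) m (ℕₚ.m<n⇒m<1+n (ℕₚ.n<1+n m)))) ⟩
        c₀ * (σ m * (1# * 1#)) + _ * 0# + _ * 0#
          ≈⟨ solve 4 (λ c s y z → c :* (s :* (:1 :* :1)) :+ y :* con (+ 0) :+ z :* con (+ 0) := c :* s :* (:1 :* :1)) refl _ _ _ _ ⟩
        σ (suc m) * (1# * 1#) ∎
        where c₀ = 1-q^ (suc m) * 1-q^ (suc m) * 1-q^ (suc (suc m))
      A≈B (suc n) zero    = begin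
        1-q^ 1 * 1-q^ 1 * A 0 (n ℕ.+ 0) + 1-q^ 1 * A 1 (n ℕ.+ 0)  ≈⟨ +-comm _ _ ⟩
        1-q^ 1 * A 1 (n ℕ.+ 0) + 1-q^ 1 * 1-q^ 1 * A 0 (n ℕ.+ 0)  ≈⟨ A≈B′ n 0 ⟩
        1-q^ 1 * 1-q^ 1 * 1-q^ 1 * (s^ n * B 2 n)                 ≈⟨ *-congʳ (*-congʳ (λ-even 0)) ⟨
        s * λ' 0 * 1-q^ 1 * (s^ n * B 2 n)
          ≈⟨ solve 5 (λ s l p w b → s :* l :* p :* (w :* b) := p :* (s :* w :* (con (+ 0) :+ l :* b))) refl s (λ' 0) (1-q^ 1) (s^ n) (B 2 n) ⟩
        1-q^ 1 * (s * s^ n * (0# + λ' 0 * B 2 n))           ∎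
      A≈B (suc n) (suc m) = begin
        p₁ * p₁ * p₂ * A m N + (p₁ * p₂ + p₂ * p₂) * A (suc m) N + p₂ * A (suc (suc m)) N
          -- The weight of the level step is split: its part p₂² joins the down-step to form the
          -- left side of `A≈B′` at `suc m`.
          ≈⟨ solve 5 (λ p₁ p₂ x y z → p₁ :* p₁ :* p₂ :* x :+ (p₁ :* p₂ :+ p₂ :* p₂) :* y :+ p₂ :* z
               := p₁ :* p₁ :* p₂ :* x :+ p₁ :* p₂ :* y :+ (p₂ :* z :+ p₂ :* p₂ :* y)) refl p₁ p₂ _ _ _ ⟩
        p₁ * p₁ * p₂ * A m N + p₁ * p₂ * A (suc m) N + (p₂ * A (suc (suc m)) N + p₂ * p₂ * A (suc m) N)
          ≈⟨ +-cong (+-cong (*-congˡ (trans (reflexive (≡.cong (A m) (ℕₚ.+-suc n m))) (A≈B (suc n) m)))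
                            (*-congˡ (A≈B n (suc m)))) (A≈B′ n (suc m)) ⟩
        p₁ * p₁ * p₂ * (σ m * (s * s^ n * b₁)) + p₁ * p₂ * (σ (suc m) * (s^ n * b₃))
          + p₂ * p₂ * σ (suc m) * (s^ n * b₄)
          ≈⟨ +-cong (+-congˡ (*-congʳ (λ-odd m))) (*-congʳ (*-congʳ (λ-even (suc m)))) ⟨
        p₁ * p₁ * p₂ * (σ m * (s * s^ n * b₁)) + s * l₁ * (σ (suc m) * (s^ n * b₃))
          + s * l₂ * σ (suc m) * (s^ n * b₄)
          ≈⟨ solve 9 (λ c σ s w b₁ b₃ b₄ l₁ l₂ →
               c :* (σ :* (s :* w :* b₁)) :+ s :* l₁ :* (c :* σ :* (w :* b₃)) :+ s :* l₂ :* (c :* σ) :* (w :* b₄)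
               := c :* σ :* (s :* w :* (b₁ :+ l₁ :* b₃ :+ l₂ :* b₄)))
               refl (p₁ * p₁ * p₂) (σ m) s (s^ n) b₁ b₃ b₄ l₁ l₂ ⟩
        σ (suc m) * (s * s^ n * (b₁ + l₁ * b₃ + l₂ * b₄)) ∎
        where
        N = n ℕ.+ suc m
        p₁ = 1-q^ (suc m)
        p₂ = 1-q^ (suc (suc m))
        l₁ = λ' (suc (m ℕ.* 2))
        l₂ = λ' (suc m ℕ.* 2)
        b₁ = B (suc (m ℕ.* 2)) (suc n)
        b₃ = B (suc (suc m ℕ.* 2)) n
        b₄ = B (suc (suc (suc m ℕ.* 2))) n

      A≈B′ zero    m = begin
        p₁ * A (suc m) m + p₁ * p₁ * A m m
          ≈⟨ +-cong (*-congˡ (A-above (suc m) m (ℕₚ.n<1+n m))) (*-congˡ (A≈B 0 m)) ⟩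
        p₁ * 0# + p₁ * p₁ * (σ m * (1# * 1#))
          ≈⟨ solve 2 (λ p σ → p :* con (+ 0) :+ p :* p :* (σ :* (:1 :* :1)) := p :* p :* σ :* (:1 :* :1)) refl p₁ (σ m) ⟩
        p₁ * p₁ * σ m * (1# * 1#) ∎
        where p₁ = 1-q^ (suc m)
      A≈B′ (suc n) m = begin
        p₁ * A (suc m) (suc n ℕ.+ m) + p₁ * p₁ * A m (suc n ℕ.+ m)
          ≈⟨ +-cong (*-congˡ (trans (reflexive (≡.cong (A (suc m)) (≡.sym (ℕₚ.+-suc n m)))) (A≈B n (suc m))))
                    (*-congˡ (A≈B (suc n) m)) ⟩
        p₁ * (σ (suc m) * (s^ n * b₃)) + p₁ * p₁ * (σ m * (s * s^ n * b₁))
          ≈⟨ solve 7 (λ p₁ p₂ σ s w b₁ b₃ →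
               p₁ :* (p₁ :* p₁ :* p₂ :* σ :* (w :* b₃)) :+ p₁ :* p₁ :* (σ :* (s :* w :* b₁))
               := p₁ :* p₁ :* σ :* w :* (s :* b₁ :+ p₁ :* p₂ :* b₃))
               refl p₁ (1-q^ (suc (suc m))) (σ m) s (s^ n) b₁ b₃ ⟩
        p₁ * p₁ * σ m * s^ n * (s * b₁ + p₁ * 1-q^ (suc (suc m)) * b₃)
          ≈⟨ *-congˡ (+-congˡ (*-congʳ (λ-odd m))) ⟨
        p₁ * p₁ * σ m * s^ n * (s * b₁ + s * l₁ * b₃)
          ≈⟨ solve 6 (λ c w s b₁ b₃ l → c :* w :* (s :* b₁ :+ s :* l :* b₃) := c :* (s :* w :* (b₁ :+ l :* b₃)))
               refl (p₁ * p₁ * σ m) (s^ n) s b₁ b₃ l₁ ⟩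
        p₁ * p₁ * σ m * (s * s^ n * (b₁ + l₁ * b₃)) ∎
        where
        p₁ = 1-q^ (suc m)
        l₁ = λ' (suc (m ℕ.* 2))
        b₁ = B (suc (m ℕ.* 2)) (suc n)
        b₃ = B (suc (suc m ℕ.* 2)) n

      A₀≈B : ∀ n → A 0 n ≈ 1-q^ 1 * (s^ n * B 1 n)
      A₀≈B n = trans (reflexive (≡.cong (A 0) (≡.sym (ℕₚ.+-identityʳ n)))) (A≈B n 0)

  -- The sequences P and Y.

  module _ (P : ℕ → Carrier) (odd : ℕ → Carrier) (odd-zero : odd 0 ≈ 1#)
    (odd-suc : ∀ j → odd (suc j) ≈ odd j + (1# + 1#))
    (P-zero : P 0 ≈ 0#) (P-suc : ∀ j → P (suc j) ≈ q^ j * P j + sign j * odd j) where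

    P-one : P 1 ≈ 1#
    P-one = trans (P-suc 0) (trans (+-cong (*-congˡ P-zero) (*-congˡ odd-zero))
      (solve 0 (:1 :* con (+ 0) :+ :1 :* :1 := :1) refl))

    -- Eliminating the weights 2m + 1 between consecutive first-order recurrences of P leaves, for
    -- sums of neighbours, a second-order recurrence whose inhomogeneous term is a constant times
    -- the sign: the one defining `H 0`.
    P+P≈H : ∀ i → P i + P (suc i) ≈ H 0 i
    P+P≈H zero          = trans (+-cong P-zero P-one) (+-identityˡ _)
    P+P≈H (suc zero)    = trans
      (+-cong P-one (trans (P-suc 1) (+-cong (*-congˡ P-one) (*-congˡ (trans (odd-suc 0) (+-congʳ odd-zero))))))
      (solve 1 (λ q → :1 :+ (q :* :1 :* :1 :+ :- :1 :* (:1 :+ :2)) := :- (:1 :+ (:1 :- q :* :1) :* :1)) refl q)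
    P+P≈H (suc (suc i)) = begin
      P (2 ℕ.+ i) + P (3 ℕ.+ i)
        ≈⟨ +-cong P₂ P₃ ⟩
      x₂ + x₃
        ≈⟨ solve 5 (λ q Q x s o → let x₁ = Q :* x :+ s :* o
                                      x₂ = q :* Q :* x₁ :+ :- s :* (o :+ :2)
                                      x₃ = q :* (q :* Q) :* x₂ :+ :- (:- s) :* (o :+ :2 :+ :2) in
             x₂ :+ x₃ := :H (q :* :1) (q :* Q) (x₁ :+ x₂) (x :+ x₁) ((:1 :- q :* :1) :* :1) s)
             refl q (q^ i) (P i) (sign i) (odd i) ⟩
      q^ 1 * (q^ (suc i) - 1#) * (x₁ + x₂) + q^ (suc i) * (P i + x₁) + (1# + 1#) * e 0 * sign i
        ≈⟨ +-congʳ (+-cong (*-congˡ (+-cong P₁ P₂)) (*-congˡ (+-congˡ P₁))) ⟨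
      q^ 1 * (q^ (suc i) - 1#) * (P (suc i) + P (2 ℕ.+ i)) + q^ (suc i) * (P i + P (suc i)) + (1# + 1#) * e 0 * sign i
        ≈⟨ +-congʳ (+-cong (*-congˡ (P+P≈H (suc i))) (*-congˡ (P+P≈H i))) ⟩
      H 0 (suc (suc i)) ∎
      where
      x₁ = q^ i * P i + sign i * odd i
      x₂ = q^ (suc i) * x₁ + sign (suc i) * (odd i + (1# + 1#))
      x₃ = q^ (suc (suc i)) * x₂ + sign (suc (suc i)) * (odd i + (1# + 1#) + (1# + 1#))
      P₁ : P (suc i) ≈ x₁
      P₁ = P-suc i
      P₂ : P (2 ℕ.+ i) ≈ x₂
      P₂ = trans (P-suc (suc i)) (+-cong (*-congˡ P₁) (*-congˡ (odd-suc i)))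
      P₃ : P (3 ℕ.+ i) ≈ x₃
      P₃ = trans (P-suc (suc (suc i))) (+-cong (*-congˡ P₂) (*-congˡ (trans (odd-suc (suc i)) (+-congʳ (odd-suc i)))))

  -- When `H 0 (suc i)` is added to the recurrence for `H 0 (suc (suc i))`, everything except
  -- q^(i+1) times the previous sum is visibly divisible by q - 1. Dividing it out gives this
  -- recursion, which shows that Y is polynomial.
  Y : ℕ → Carrier
  Y zero    = 1#
  Y (suc i) = q^ (suc i) * Y i + (q^ (suc i) - 1#) * H 0 (suc i) - (1# + 1#) * sign i

  [q-1]Y≈H+H : ∀ i → (q - 1#) * Y i ≈ H 0 i + H 0 (suc i)
  [q-1]Y≈H+H zero    = solve 1 (λ q → (q :- :1) :* :1 := :1 :+ :- (:1 :+ (:1 :- q :* :1) :* :1)) refl q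
  [q-1]Y≈H+H (suc i) = begin
    (q - 1#) * Y (suc i)
      ≈⟨ solve 5 (λ q Q Y h s → (q :- :1) :* (Q :* Y :+ (Q :- :1) :* h :- :2 :* s)
           := Q :* ((q :- :1) :* Y) :+ (q :- :1) :* ((Q :- :1) :* h :- :2 :* s))
           refl q (q^ (suc i)) (Y i) (H 0 (suc i)) (sign i) ⟩
    q^ (suc i) * ((q - 1#) * Y i) + (q - 1#) * ((q^ (suc i) - 1#) * H 0 (suc i) - (1# + 1#) * sign i)
      ≈⟨ +-congʳ (*-congˡ ([q-1]Y≈H+H i)) ⟩
    q^ (suc i) * (H 0 i + H 0 (suc i)) + (q - 1#) * ((q^ (suc i) - 1#) * H 0 (suc i) - (1# + 1#) * sign i)
      ≈⟨ solve 5 (λ q Q h0 h1 s → Q :* (h0 :+ h1) :+ (q :- :1) :* ((Q :- :1) :* h1 :- :2 :* s)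
           := h1 :+ :H (q :* :1) Q h1 h0 ((:1 :- q :* :1) :* :1) s)
           refl q (q^ (suc i)) (H 0 i) (H 0 (suc i)) (sign i) ⟩
    H 0 (suc i) + H 0 (suc (suc i)) ∎

  -- Comparison of the two sides.

  module _ (q-cancel : ∀ x → q * x ≈ 0# → x ≈ 0#) (1-q-cancel : ∀ x → (1# - q) * x ≈ 0# → x ≈ 0#)
    (β : ℕ → ℕ → Carrier) (β-zero : β 0 0 ≈ 1#) (β-suc : ∀ n → Reflected (β n) (β (suc n)))
    (β-above : ∀ n k → n ℕ.< k → β n k ≈ 0#) where

    -- `A 0` and `orbit η 0` take opposite values under every X_j, so they are opposite sequences.
    -- The first is (1 - q)x at n, the second (q - 1) times the ballot sum, and 1 - q cancels.
    expansion : ∀ n x → A 0 n ≈ 1-q^ 1 * x → x ≈ ∑ (suc n) (λ k → β n k * Y k)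
    expansion n x A≈ = begin
      x              ≈⟨ solve 2 (λ x z → x := (x :- z) :+ z) refl x z ⟩
      (x - z) + z    ≈⟨ +-congʳ (1-q-cancel _ difference) ⟩
      0# + z         ≈⟨ +-identityˡ z ⟩
      z              ∎
      where
      z = ∑ (suc n) (λ k → β n k * Y k)
      η : ℕ → Carrier
      η m = H 0 m + H 0 (suc m)

      orbit≈ : orbit η 0 n ≈ (q - 1#) * z
      orbit≈ = begin
        orbit η 0 n
          ≡⟨ ≡.cong (orbit η 0) (ℕₚ.+-identityʳ n) ⟨
        orbit η 0 (n ℕ.+ 0)
          ≈⟨ ∑-ballot β β-zero β-suc β-above η n 0 ⟨
        ∑ (suc n) (λ k → β n k * η k)
          ≈⟨ ∑-cong-< (suc n) (λ k _ → trans (*-congˡ (sym ([q-1]Y≈H+H k)))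
               (solve 3 (λ b c y → b :* (c :* y) := c :* (b :* y)) refl _ _ _)) ⟩
        ∑ (suc n) (λ k → (q - 1#) * (β n k * Y k))
          ≈⟨ *-∑ (suc n) (q - 1#) _ ⟩
        (q - 1#) * z ∎

      difference : (1# - q) * (x - z) ≈ 0#
      difference = begin
        (1# - q) * (x - z)
          ≈⟨ solve 3 (λ q x z → (:1 :- q) :* (x :- z) := (:1 :- q :* :1) :* x :+ (q :- :1) :* z) refl q x z ⟩
        1-q^ 1 * x + (q - 1#) * z
          ≈⟨ +-cong A≈ orbit≈ ⟨
        A 0 n + orbit η 0 n
          ≈⟨ Φ-injective q-cancel (A 0) (orbit η 0) (λ j → trans
               (+-cong (Φ-A-zero j) (Φ-orbit-zero η (λ _ → refl) j)) (-‿inverseʳ (e j))) n ⟩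
        0# ∎

-- The ring of integer polynomials given by coefficient lists.

open import Defs
open import Data.Product using (Σ; ∃; _×_; _,_)
open ≡ using (refl)
open import Data.Nat using (_≤_; _*_)

private module ℤ-Sums = Sums ℤₚ.+-*-commutativeRing

coeff-⊕ : ∀ p r i → coeff (p ⊕ r) i ≡ coeff p i ℤ.+ coeff r i
coeff-⊕ []      r       i       = ≡.sym (ℤₚ.+-identityˡ _)
coeff-⊕ (a ∷ p) []      i       = ≡.sym (ℤₚ.+-identityʳ _)
coeff-⊕ (a ∷ p) (b ∷ r) zero    = refl
coeff-⊕ (a ∷ p) (b ∷ r) (suc i) = coeff-⊕ p r i

coeff-· : ∀ c p i → coeff (c · p) i ≡ c ℤ.* coeff p i
coeff-· c []      i       = ≡.sym (ℤₚ.*-zeroʳ c)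
coeff-· c (a ∷ p) zero    = refl
coeff-· c (a ∷ p) (suc i) = coeff-· c p i

coeff-⊝ : ∀ p i → coeff (⊝ p) i ≡ ℤ.- coeff p i
coeff-⊝ p i = ≡.trans (coeff-· (ℤ.- (+ 1)) p i) (ℤₚ.-1*i≡-i _)

-- Multiplication of lists recurses on the left factor exactly as `conv` does, so the laws of `⊛`
-- follow from those of `conv` over the integers.
coeff-⊛ : ∀ p r n → coeff (p ⊛ r) n ≡ ℤ-Sums.conv (coeff p) (coeff r) n
coeff-⊛ []      r n       = ≡.sym (ℤ-Sums.conv-zeroˡ n _ (coeff r) (λ _ _ → refl))
coeff-⊛ (a ∷ p) r zero    = ≡.trans (coeff-⊕ (a · r) _ 0)
  (≡.trans (ℤₚ.+-identityʳ _) (coeff-· a r 0))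
coeff-⊛ (a ∷ p) r (suc n) = ≡.trans (coeff-⊕ (a · r) _ (suc n))
  (cong₂ ℤ._+_ (coeff-· a r (suc n)) (coeff-⊛ p r n))

⊕-cong : ∀ {p p' r r'} → p ≈ p' → r ≈ r' → p ⊕ r ≈ p' ⊕ r'
⊕-cong {p} {p'} {r} {r'} e f i = ≡.trans (coeff-⊕ p r i)
  (≡.trans (cong₂ ℤ._+_ (e i) (f i)) (≡.sym (coeff-⊕ p' r' i)))

⊛-cong : ∀ {p p' r r'} → p ≈ p' → r ≈ r' → p ⊛ r ≈ p' ⊛ r'
⊛-cong {p} {p'} {r} {r'} e f i = ≡.trans (coeff-⊛ p r i)
  (≡.trans (≡.trans (ℤ-Sums.conv-congˡ i (coeff r) (λ k _ → e k)) (ℤ-Sums.conv-congʳ i (coeff p') f))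
    (≡.sym (coeff-⊛ p' r' i)))

⊕-assoc : ∀ p r t → (p ⊕ r) ⊕ t ≈ p ⊕ (r ⊕ t)
⊕-assoc p r t i
  rewrite coeff-⊕ (p ⊕ r) t i | coeff-⊕ p r i | coeff-⊕ p (r ⊕ t) i | coeff-⊕ r t i
  = ℤₚ.+-assoc (coeff p i) _ _

⊕-comm : ∀ p r → p ⊕ r ≈ r ⊕ p
⊕-comm p r i rewrite coeff-⊕ p r i | coeff-⊕ r p i = ℤₚ.+-comm (coeff p i) _

⊛-assoc : ∀ p r t → (p ⊛ r) ⊛ t ≈ p ⊛ (r ⊛ t)
⊛-assoc p r t i = ≡.trans (coeff-⊛ (p ⊛ r) t i)
  (≡.trans (ℤ-Sums.conv-congˡ i (coeff t) (λ k _ → coeff-⊛ p r k))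
  (≡.trans (ℤ-Sums.conv-assoc i (coeff p) (coeff r) (coeff t))
  (≡.trans (ℤ-Sums.conv-congʳ i (coeff p) (λ k → ≡.sym (coeff-⊛ r t k)))
  (≡.sym (coeff-⊛ p (r ⊛ t) i)))))

⊛-comm : ∀ p r → p ⊛ r ≈ r ⊛ p
⊛-comm p r i = ≡.trans (coeff-⊛ p r i) (≡.trans (ℤ-Sums.conv-comm i _ _) (≡.sym (coeff-⊛ r p i)))

⊛-identityˡ : ∀ p → 1P ⊛ p ≈ p
⊛-identityˡ p i = ≡.trans (coeff-⊛ 1P p i) (ℤ-Sums.conv-identityˡ i _ (coeff p) refl (λ _ → refl))

⊛-distribˡ-⊕ : ∀ p r t → p ⊛ (r ⊕ t) ≈ p ⊛ r ⊕ p ⊛ t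
⊛-distribˡ-⊕ p r t i = ≡.trans (coeff-⊛ p (r ⊕ t) i)
  (≡.trans (ℤ-Sums.conv-congʳ i (coeff p) (coeff-⊕ r t))
  (≡.trans (ℤ-Sums.conv-+ʳ i (coeff p) (coeff r) (coeff t))
  (≡.trans (cong₂ ℤ._+_ (≡.sym (coeff-⊛ p r i)) (≡.sym (coeff-⊛ p t i)))
  (≡.sym (coeff-⊕ (p ⊛ r) (p ⊛ t) i)))))

-- Wrapping _≈_ in a record lets the two sides of an equation be inferred.
infix 4 _≋_
record _≋_ (p r : Poly) : Set where
  constructor pointwise
  field coeffs : p ≈ r
open _≋_

polyRing : CommutativeRing 0ℓ 0ℓ
polyRing = record
  { Carrier = Poly ; _≈_ = _≋_ ; _+_ = _⊕_ ; _*_ = _⊛_ ; -_ = ⊝_ ; 0# = 0P ; 1# = 1P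
  ; isCommutativeRing = record
    { isRing = record
      { +-isAbelianGroup = record
        { isGroup = record
          { isMonoid = record
            { isSemigroup = record
              { isMagma = record
                { isEquivalence = record
                  { refl  = pointwise (λ i → refl)
                  ; sym   = λ e → pointwise (λ i → ≡.sym (coeffs e i))
                  ; trans = λ e f → pointwise (λ i → ≡.trans (coeffs e i) (coeffs f i)) }
                ; ∙-cong = λ {p} {p'} {r} {r'} e f → pointwise (⊕-cong {p} {p'} {r} {r'} (coeffs e) (coeffs f)) }
              ; assoc = λ p r t → pointwise (⊕-assoc p r t) }
            ; identity = (λ p → pointwise (λ i → refl)) , (λ p → pointwise (⊕-comm p [])) }
          ; inverse = (λ p → pointwise (⊝-inverseˡ p))
                    , (λ p → pointwise (λ i → ≡.trans (⊕-comm p (⊝ p) i) (⊝-inverseˡ p i)))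
          ; ⁻¹-cong = λ {p} {r} e → pointwise (λ i →
              ≡.trans (coeff-⊝ p i) (≡.trans (cong ℤ.-_ (coeffs e i)) (≡.sym (coeff-⊝ r i)))) }
        ; comm = λ p r → pointwise (⊕-comm p r) }
      ; *-cong = λ {p} {p'} {r} {r'} e f → pointwise (⊛-cong {p} {p'} {r} {r'} (coeffs e) (coeffs f))
      ; *-assoc = λ p r t → pointwise (⊛-assoc p r t)
      ; *-identity = (λ p → pointwise (⊛-identityˡ p))
                   , (λ p → pointwise (λ i → ≡.trans (⊛-comm p 1P i) (⊛-identityˡ p i)))
      ; distrib = (λ p r t → pointwise (⊛-distribˡ-⊕ p r t))
                , (λ p r t → pointwise (λ i → ≡.trans (⊛-comm (r ⊕ t) p i) (≡.trans (⊛-distribˡ-⊕ p r t i)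
                    (⊕-cong {p ⊛ r} {r ⊛ p} {p ⊛ t} {t ⊛ p} (⊛-comm p r) (⊛-comm p t) i)))) }
    ; *-comm = λ p r → pointwise (⊛-comm p r) } }
  where
  ⊝-inverseˡ : ∀ p → ⊝ p ⊕ p ≈ 0P
  ⊝-inverseˡ p i rewrite coeff-⊕ (⊝ p) p i | coeff-⊝ p i = ℤₚ.+-inverseˡ (coeff p i)

open CommutativeRing polyRing using (setoid; +-cong; +-congʳ; +-congˡ; *-cong; *-congˡ; *-congʳ; zeroʳ; -‿inverseʳ; -‿cong; *-assoc; *-identityʳ; *-commutativeSemigroup)
  renaming (refl to ≋-refl; sym to ≋-sym; trans to ≋-trans)
open CommutativeSemigroupProperties *-commutativeSemigroup using (x∙yz≈y∙xz)
open Sums polyRing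
open Moments polyRing qP
open import Relation.Binary.Reasoning.Setoid setoid

-- Truncated continued fractions as power series.

sumP≋∑ : ∀ n f → sumP n f ≋ ∑ n f
sumP≋∑ zero    f = ≋-refl
sumP≋∑ (suc n) f = +-congʳ {f n} (sumP≋∑ n f)

mulS≋conv : ∀ a b n → mulS a b n ≋ conv a b n
mulS≋conv a b n = ≋-trans (sumP≋∑ (suc n) (λ i → a i ⊛ b (n ℕ.∸ i))) (∑≈conv n a b)

powS-suc-suc : ∀ a k n → powS (zS a) (suc k) (suc n) ≋ conv a (powS (zS a) k) n
powS-suc-suc a k n = mulS≋conv (zS a) (powS (zS a) k) (suc n)

powS-vanishes : ∀ a k n → n ℕ.< k → powS (zS a) k n ≋ 0P
powS-vanishes a (suc k) zero    _         = mulS≋conv (zS a) (powS (zS a) k) 0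
powS-vanishes a (suc k) (suc n) (s≤s n<k) = ≋-trans (powS-suc-suc a k n)
  (≋-trans (conv-comm n a (powS (zS a) k))
    (conv-zeroˡ n (powS (zS a) k) a (λ i i≤n → powS-vanishes a k i (ℕₚ.≤-<-trans i≤n n<k))))

-- This is G = 1 + z a G beyond the constant term: one factor z a is taken out of every positive
-- power.
geoS-suc : ∀ a n → geoS a (suc n) ≋ conv a (geoS a) n
geoS-suc a n = begin
  geoS a (suc n)                                        ≈⟨ sumP≋∑ (suc (suc n)) (λ k → powS (zS a) k (suc n)) ⟩
  ∑ (suc (suc n)) (λ k → powS (zS a) k (suc n))         ≈⟨ ∑-head (suc n) (λ k → powS (zS a) k (suc n)) ⟩
  ∑ (suc n) (λ k → powS (zS a) (suc k) (suc n))         ≈⟨ ∑-cong-< (suc n) (λ k _ → powS-suc-suc a k n) ⟩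
  ∑ (suc n) (λ k → conv a (powS (zS a) k) n)            ≈⟨ ∑-conv (suc n) n a (powS (zS a)) ⟩
  conv a (λ i → ∑ (suc n) (λ k → powS (zS a) k i)) n    ≈⟨ conv-congʳ-≤ n a truncate ⟩
  conv a (geoS a) n                                     ∎
  where
  -- `geoS a i` stops at power i, while the sum here runs up to power n. The extra powers of z a
  -- have no terms of order i.
  truncate : ∀ i → i ℕ.≤ n → ∑ (suc n) (λ k → powS (zS a) k i) ≋ geoS a i
  truncate i i≤n = ≋-trans
    (∑-truncate (suc i) (suc n) (λ k → powS (zS a) k i) (λ k i<k → powS-vanishes a k i i<k) (s≤s i≤n))
    (≋-sym (sumP≋∑ (suc i) (λ k → powS (zS a) k i)))

cfTrunc-zero : ∀ d h → cfTrunc d h 0 ≋ 1P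
cfTrunc-zero zero    h = ≋-refl
cfTrunc-zero (suc d) h = ≋-refl

cfTrunc-suc : ∀ d h n → cfTrunc (suc d) h (suc n) ≋ lam (suc h) ⊛ conv (cfTrunc d (suc h)) (cfTrunc (suc d) h) n
cfTrunc-suc d h n = begin
  f (suc n)                ≈⟨ geoS-suc (scaleS l g) n ⟩
  conv (scaleS l g) f n    ≈⟨ conv-comm n (scaleS l g) f ⟩
  conv f (scaleS l g) n    ≈⟨ conv-scaleʳ n l f g ⟩
  l ⊛ conv f g n           ≈⟨ *-congˡ {l} (conv-comm n f g) ⟩
  l ⊛ conv g f n           ∎
  where
  l = lam (suc h)
  g = cfTrunc d (suc h)
  f = cfTrunc (suc d) h

-- Multiplication by q and 1 - q, and q-integers.

∷-cong : ∀ {a b p r} → a ≡ b → p ≋ r → a ∷ p ≋ b ∷ r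
∷-cong a≡b p≋r = pointwise λ { zero → a≡b ; (suc i) → coeffs p≋r i }

0∷[] : + 0 ∷ [] ≋ 0P
0∷[] = pointwise λ { zero → refl ; (suc i) → refl }

singleton-⊛ : ∀ c p → (c ∷ []) ⊛ p ≋ c · p
singleton-⊛ c p = ≋-trans (+-congˡ {c · p} 0∷[]) (pointwise (⊕-comm (c · p) []))

qP-⊛ : ∀ p → qP ⊛ p ≋ + 0 ∷ p
qP-⊛ p = pointwise λ
  { zero    → coeff-⊛ qP p 0
  ; (suc i) → ≡.trans (coeff-⊛ qP p (suc i))
      (≡.trans (ℤₚ.+-identityˡ _) (ℤ-Sums.conv-identityˡ i _ (coeff p) refl (λ _ → refl))) }

qP-cancel : ∀ p → qP ⊛ p ≋ 0P → p ≋ 0P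
qP-cancel p eq = pointwise λ i → ≡.trans (≡.sym (coeffs (qP-⊛ p) (suc i))) (coeffs eq (suc i))

-- The hypothesis gives p = qp, so the constant coefficient is 0 and every other one equals its
-- predecessor.
1-qP-cancel : ∀ p → (1P ⊖ qP) ⊛ p ≋ 0P → p ≋ 0P
1-qP-cancel p eq = pointwise vanishes
  where
  p≋0∷p : p ≋ + 0 ∷ p
  p≋0∷p = begin
    p                        ≈⟨ split p ⟩
    (1P ⊖ qP) ⊛ p ⊕ qP ⊛ p   ≈⟨ +-cong {(1P ⊖ qP) ⊛ p} {0P} {qP ⊛ p} {+ 0 ∷ p} eq (qP-⊛ p) ⟩
    + 0 ∷ p                  ∎
  vanishes : p ≈ 0P
  vanishes zero    = coeffs p≋0∷p 0
  vanishes (suc i) = ≡.trans (coeffs p≋0∷p (suc i)) (vanishes i)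

qpow≋q^ : ∀ e → qpow e ≋ q^ e
qpow≋q^ zero    = ≋-refl
qpow≋q^ (suc e) = ≋-trans (≋-sym (qP-⊛ (qpow e))) (*-congˡ {qP} (qpow≋q^ e))

qint-suc : ∀ m → qint (suc m) ≋ 1P ⊕ qP ⊛ qint m
qint-suc m = +-congˡ {1P} {+ 0 ∷ qint m} {qP ⊛ qint m} (≋-sym (qP-⊛ (qint m)))

[1-q]qint≋1-q^ : ∀ m → (1P ⊖ qP) ⊛ qint m ≋ 1-q^ m
[1-q]qint≋1-q^ zero    = ≋-trans (zeroʳ (1P ⊖ qP)) (≋-sym (-‿inverseʳ 1P))
[1-q]qint≋1-q^ (suc m) = ≋-trans (*-congˡ {1P ⊖ qP} (qint-suc m)) (1-q^-suc m (qint m) ([1-q]qint≋1-q^ m))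

-- `lamAt` trades two units of its second argument for one unit of the first, so r alone decides
-- between the square and the mixed product.
lamAt-double : ∀ m k r → lamAt k (r ℕ.+ m ℕ.* 2) ≡ lamAt (m ℕ.+ k) r
lamAt-double zero    k r = cong (lamAt k) (ℕₚ.+-identityʳ r)
lamAt-double (suc m) k r = ≡.trans (cong (lamAt k) (≡.trans (ℕₚ.+-suc r _) (cong suc (ℕₚ.+-suc r _))))
  (≡.trans (lamAt-double m (suc k) r) (cong (λ i → lamAt i r) (ℕₚ.+-suc m k)))

[1-q]² : Poly
[1-q]² = (1P ⊖ qP) ⊛ (1P ⊖ qP)

[1-q]²-⊛ : ∀ m n → [1-q]² ⊛ (qint m ⊛ qint n) ≋ 1-q^ m ⊛ 1-q^ n
[1-q]²-⊛ m n = square-* (1P ⊖ qP) {qint m} {1-q^ m} {qint n} {1-q^ n} ([1-q]qint≋1-q^ m) ([1-q]qint≋1-q^ n)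

lam-odd : ∀ m → [1-q]² ⊛ lam (suc (m ℕ.* 2)) ≋ 1-q^ (suc m) ⊛ 1-q^ (suc m)
lam-odd m rewrite lamAt-double m 1 0 | ℕₚ.+-comm m 1 = [1-q]²-⊛ (suc m) (suc m)

lam-even : ∀ m → [1-q]² ⊛ lam (suc (suc (m ℕ.* 2))) ≋ 1-q^ (suc m) ⊛ 1-q^ (suc (suc m))
lam-even m rewrite lamAt-double m 1 1 | ℕₚ.+-comm m 1 = [1-q]²-⊛ (suc m) (suc (suc m))

open ContinuedFraction (λ h → lam (suc h))
-- `λ'` is `lam` with its index lowered by one, so the odd case of `lam` serves as the even case
-- here, and conversely.
open Contraction [1-q]² lam-odd lam-even

[1-q]^2n≋s^ : ∀ n → (1P ⊖ qP) ^P (2 ℕ.* n) ≋ s^ n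
[1-q]^2n≋s^ zero    = ≋-refl
[1-q]^2n≋s^ (suc n) rewrite ℕₚ.+-suc n (n ℕ.+ 0) = ≋-trans
  (≋-sym (*-assoc (1P ⊖ qP) (1P ⊖ qP) ((1P ⊖ qP) ^P (2 ℕ.* n))))
  (*-congˡ {[1-q]²} {(1P ⊖ qP) ^P (2 ℕ.* n)} {s^ n} ([1-q]^2n≋s^ n))

-- Ballot numbers and their reflected recurrence.

binomZ-pascal : ∀ N z → binomZ (suc N) z ≡ binomZ N (z ℤ.- + 1) ℤ.+ binomZ N z
binomZ-pascal N (+ zero)  = refl
binomZ-pascal N (+ suc j) = cong +_ (≡.sym (nCk+nC[k+1]≡[n+1]C[k+1] N j))
binomZ-pascal N -[1+ t ]  = refl

-- Row 2n is symmetric about n. For n = 0 both sides are 0, the right one because its lower index is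
-- negative.
binomZ-central : ∀ n → binomZ (2 ℕ.* n) (+ suc n) ≡ binomZ (2 ℕ.* n) (+ n ℤ.- + 1)
binomZ-central zero    = refl
binomZ-central (suc n) = cong +_ (≡.trans (nCk≡nC[n∸k] {suc (suc n)} {2 ℕ.* suc n} 2+n≤) (cong ((2 ℕ.* suc n) C_) difference))
  where
  2+n+n≡ : 2 ℕ.* suc n ≡ suc (suc n) ℕ.+ n
  2+n+n≡ = cong suc (≡.trans (ℕₚ.+-suc n (n ℕ.+ 0)) (cong (λ k → suc (n ℕ.+ k)) (ℕₚ.+-identityʳ n)))
  2+n≤ : suc (suc n) ℕ.≤ 2 ℕ.* suc n
  2+n≤ = ≡.subst (suc (suc n) ℕ.≤_) (≡.sym 2+n+n≡) (ℕₚ.m≤m+n (suc (suc n)) n)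
  difference : 2 ℕ.* suc n ℕ.∸ suc (suc n) ≡ n
  difference = ≡.trans (cong (ℕ._∸ suc (suc n)) 2+n+n≡) (ℕₚ.m+n∸m≡n (suc (suc n)) n)

module _ (n : ℕ) where
  open +-*-Solver renaming (con to conℤ; _:=_ to _:≡_; solve to solveℤ; _:+_ to _⟨+⟩_; _:-_ to _⟨-⟩_; _:*_ to _⟨*⟩_)
  private
    b b″ : ℤ → ℤ
    b  = binomZ (2 ℕ.* n)
    b″ = binomZ (2 ℕ.* suc n)

  binomZ-pascal² : ∀ z → b″ z ≡ b (z ℤ.- + 1 ℤ.- + 1) ℤ.+ b (z ℤ.- + 1) ℤ.+ (b (z ℤ.- + 1) ℤ.+ b z)
  binomZ-pascal² z = ≡.trans (cong (λ N → binomZ (suc N) z) (ℕₚ.+-suc n (n ℕ.+ 0)))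
    (≡.trans (binomZ-pascal (suc (2 ℕ.* n)) z)
      (cong₂ ℤ._+_ (binomZ-pascal (2 ℕ.* n) (z ℤ.- + 1)) (binomZ-pascal (2 ℕ.* n) z)))

  -- Two Pascal steps multiply by (1 + x)², which is x + 2 + 1/x after centring, and this passes to
  -- differences.
  ballot-suc-suc : ∀ k → ballot (suc n) (suc k) ≡ ballot n k ℤ.+ + 2 ℤ.* ballot n (suc k) ℤ.+ ballot n (suc (suc k))
  ballot-suc-suc k = ≡.trans (cong (λ w → b″ w ℤ.- b″ (w ℤ.- + 1)) e₀)
    (≡.trans (cong₂ ℤ._-_ (binomZ-pascal² z) (binomZ-pascal² (z ℤ.- + 1)))
    (≡.trans (solveℤ 4 (λ b₀ b₁ b₂ b₃ →
        (b₂ ⟨+⟩ b₁ ⟨+⟩ (b₁ ⟨+⟩ b₀)) ⟨-⟩ (b₃ ⟨+⟩ b₂ ⟨+⟩ (b₂ ⟨+⟩ b₁))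
        :≡ (b₀ ⟨-⟩ b₁) ⟨+⟩ conℤ (+ 2) ⟨*⟩ (b₁ ⟨-⟩ b₂) ⟨+⟩ (b₂ ⟨-⟩ b₃)) refl
        (b z) (b (z ℤ.- + 1)) (b (z ℤ.- + 1 ℤ.- + 1)) (b (z ℤ.- + 1 ℤ.- + 1 ℤ.- + 1)))
    (cong₂ (λ u v → ballot n k ℤ.+ + 2 ℤ.* (b u ℤ.- b (u ℤ.- + 1)) ℤ.+ (b v ℤ.- b (v ℤ.- + 1))) (≡.sym e₁) (≡.sym e₂))))
    where
    z = + n ℤ.- + k
    e₀ : + suc n ℤ.- + suc k ≡ z
    e₀ = solveℤ 2 (λ n k → (conℤ (+ 1) ⟨+⟩ n) ⟨-⟩ (conℤ (+ 1) ⟨+⟩ k) :≡ n ⟨-⟩ k) refl (+ n) (+ k)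
    e₁ : + n ℤ.- + suc k ≡ z ℤ.- + 1
    e₁ = solveℤ 2 (λ n k → n ⟨-⟩ (conℤ (+ 1) ⟨+⟩ k) :≡ n ⟨-⟩ k ⟨-⟩ conℤ (+ 1)) refl (+ n) (+ k)
    e₂ : + n ℤ.- + suc (suc k) ≡ z ℤ.- + 1 ℤ.- + 1
    e₂ = solveℤ 2 (λ n k → n ⟨-⟩ (conℤ (+ 2) ⟨+⟩ k) :≡ n ⟨-⟩ k ⟨-⟩ conℤ (+ 1) ⟨-⟩ conℤ (+ 1)) refl (+ n) (+ k)

  -- The binomial at n + 1 lies across the centre; `binomZ-central` folds it back to n - 1, and this
  -- produces the boundary rule.
  ballot-suc-zero : ballot (suc n) 0 ≡ ballot n 0 ℤ.+ ballot n 1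
  ballot-suc-zero = ≡.trans (cong₂ ℤ._-_ (binomZ-pascal² (+ suc n ℤ.- + 0)) (binomZ-pascal² (+ suc n ℤ.- + 0 ℤ.- + 1)))
    (≡.trans (cong₂ (λ u v → (b (u ℤ.- + 1) ℤ.+ b u ℤ.+ (b u ℤ.+ v)) ℤ.- (b (u ℤ.- + 1 ℤ.- + 1) ℤ.+ b (u ℤ.- + 1) ℤ.+ (b (u ℤ.- + 1) ℤ.+ b u))) e₀ e₁)
    (≡.trans (solveℤ 3 (λ b₀ b₁ b₂ → (b₁ ⟨+⟩ b₀ ⟨+⟩ (b₀ ⟨+⟩ b₁)) ⟨-⟩ (b₂ ⟨+⟩ b₁ ⟨+⟩ (b₁ ⟨+⟩ b₀))
        :≡ (b₀ ⟨-⟩ b₁) ⟨+⟩ (b₁ ⟨-⟩ b₂)) refl (b z) (b (z ℤ.- + 1)) (b (z ℤ.- + 1 ℤ.- + 1)))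
    (cong (λ w → b w ℤ.- b (w ℤ.- + 1) ℤ.+ ballot n 1) (≡.sym (ℤₚ.+-identityʳ z)))))
    where
    z = + n
    e₀ : + suc n ℤ.- + 0 ℤ.- + 1 ≡ z
    e₀ = solveℤ 1 (λ n → conℤ (+ 1) ⟨+⟩ n ⟨-⟩ conℤ (+ 0) ⟨-⟩ conℤ (+ 1) :≡ n) refl z
    e₁ : b (+ suc n ℤ.- + 0) ≡ b (z ℤ.- + 1)
    e₁ = ≡.trans (cong b (ℤₚ.+-identityʳ (+ suc n))) (binomZ-central n)

binomZ-negative : ∀ N {n k} → n ℕ.< k → binomZ N (+ n ℤ.- + k) ≡ + 0
binomZ-negative N {n} {k} n<k with k ℕ.∸ n | ℕₚ.m<n⇒0<n∸m n<k | ≡.trans (ℤₚ.m-n≡m⊖n n k) (ℤₚ.⊖-< n<k)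
... | suc t | _ | eq rewrite eq = refl

ballot-above : ∀ n k → n ℕ.< k → ballot n k ≡ + 0
ballot-above n k n<k = cong₂ ℤ._-_ (binomZ-negative (2 ℕ.* n) n<k)
  (≡.trans (cong (binomZ (2 ℕ.* n)) shift) (binomZ-negative (2 ℕ.* n) (ℕₚ.m<n⇒m<1+n n<k)))
  where
  open +-*-Solver
  shift : + n ℤ.- + k ℤ.- + 1 ≡ + n ℤ.- + suc k
  shift = solve 2 (λ n k → n :- k :- con (+ 1) := n :- (con (+ 1) :+ k)) refl (+ n) (+ k)

-- The first-order recurrence of P from its defining sum.

suc-C-2 : ∀ j → suc j C 2 ≡ j ℕ.+ j C 2
suc-C-2 j = ≡.trans (≡.sym (nCk+nC[k+1]≡[n+1]C[k+1] j 1)) (cong (ℕ._+ j C 2) (nC1≡n j))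

C-2-mono : ∀ {i j} → i ℕ.≤ j → i C 2 ℕ.≤ j C 2
C-2-mono {i} {zero}  z≤n = ℕₚ.≤-refl
C-2-mono {i} {suc j} i≤1+j with ℕₚ.m≤n⇒m<n∨m≡n i≤1+j
... | inj₂ refl      = ℕₚ.≤-refl
... | inj₁ (s≤s i≤j) = ≡.subst (i C 2 ℕ.≤_) (≡.sym (suc-C-2 j)) (ℕₚ.≤-trans (C-2-mono i≤j) (ℕₚ.m≤n+m (j C 2) j))

q^-+ : ∀ m n → q^ (m ℕ.+ n) ≋ q^ m ⊛ q^ n
q^-+ zero    n = ≋-sym (pointwise (⊛-identityˡ (q^ n)))
q^-+ (suc m) n = ≋-trans (*-congˡ {qP} (q^-+ m n)) (≋-sym (*-assoc qP (q^ m) (q^ n)))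

·-qpow : ∀ c e → c · qpow e ≋ (c ∷ []) ⊛ q^ e
·-qpow c e = ≋-trans (≋-sym (singleton-⊛ c (qpow e))) (*-congˡ {c ∷ []} (qpow≋q^ e))

odd : ℕ → Poly
odd j = + suc (2 ℕ.* j) ∷ []

signZ≋sign : ∀ i → signZ i ∷ [] ≋ sign i
signZ≋sign zero    = ≋-refl
signZ≋sign (suc i) = ≋-trans (∷-cong (≡.sym (ℤₚ.-1*i≡-i (signZ i))) ≋-refl)
  (-‿cong {signZ i ∷ []} (signZ≋sign i))

Pcoeff : ℕ → ℤ
Pcoeff i = signZ i ℤ.* + suc (2 ℕ.* i)

Pcoeff≋ : ∀ i → Pcoeff i ∷ [] ≋ sign i ⊛ odd i
Pcoeff≋ i = ≋-trans (∷-cong (≡.sym (ℤₚ.+-identityʳ (Pcoeff i))) ≋-refl)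
  (*-congʳ {odd i} {signZ i ∷ []} (signZ≋sign i))

odd-suc : ∀ j → odd (suc j) ≋ odd j ⊕ (1P ⊕ 1P)
odd-suc j = ∷-cong (cong +_ (≡.trans (cong suc (ℕₚ.*-suc 2 j)) (ℕₚ.+-comm 2 (suc (2 ℕ.* j))))) ≋-refl

-- Replacing C(j,2) by C(j+1,2) raises every exponent by j, and the new last term has exponent 0.
Psh-suc : ∀ j → Psh (suc j) ≋ q^ j ⊛ Psh j ⊕ sign j ⊛ odd j
Psh-suc j = +-cong {sumP j (term (suc j))} {q^ j ⊛ Psh j} earlier last
  where
  term : ℕ → ℕ → Poly
  term j i = Pcoeff i · qpow (j C 2 ℕ.∸ suc i C 2)

  last : term (suc j) j ≋ sign j ⊛ odd j
  last = begin
    term (suc j) j                    ≡⟨ cong (λ e → Pcoeff j · qpow e) (ℕₚ.n∸n≡0 (suc j C 2)) ⟩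
    Pcoeff j · 1P                     ≈⟨ ·-qpow (Pcoeff j) 0 ⟩
    (Pcoeff j ∷ []) ⊛ 1P              ≈⟨ *-identityʳ (Pcoeff j ∷ []) ⟩
    Pcoeff j ∷ []                     ≈⟨ Pcoeff≋ j ⟩
    sign j ⊛ odd j                      ∎

  term-suc : ∀ i → i ℕ.< j → term (suc j) i ≋ q^ j ⊛ term j i
  term-suc i i<j = begin
    term (suc j) i                    ≡⟨ cong (λ e → Pcoeff i · qpow e) exponent ⟩
    Pcoeff i · qpow (j ℕ.+ r)         ≈⟨ ·-qpow (Pcoeff i) (j ℕ.+ r) ⟩
    (Pcoeff i ∷ []) ⊛ q^ (j ℕ.+ r)    ≈⟨ *-congˡ {Pcoeff i ∷ []} (q^-+ j r) ⟩
    (Pcoeff i ∷ []) ⊛ (q^ j ⊛ q^ r)   ≈⟨ x∙yz≈y∙xz (Pcoeff i ∷ []) (q^ j) (q^ r) ⟩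
    q^ j ⊛ ((Pcoeff i ∷ []) ⊛ q^ r)   ≈⟨ *-congˡ {q^ j} (·-qpow (Pcoeff i) r) ⟨
    q^ j ⊛ term j i                   ∎
    where
    r = j C 2 ℕ.∸ suc i C 2
    exponent : suc j C 2 ℕ.∸ suc i C 2 ≡ j ℕ.+ r
    -- The truncated subtraction is a true one: i < j gives C(i+1,2) ≤ C(j,2).
    exponent = ≡.trans (cong (ℕ._∸ suc i C 2) (suc-C-2 j)) (ℕₚ.+-∸-assoc j (C-2-mono i<j))

  earlier : sumP j (term (suc j)) ≋ q^ j ⊛ Psh j
  earlier = begin
    sumP j (term (suc j))             ≈⟨ sumP≋∑ j (term (suc j)) ⟩
    ∑ j (term (suc j))                ≈⟨ ∑-cong-< j term-suc ⟩
    ∑ j (λ i → q^ j ⊛ term j i)       ≈⟨ *-∑ j (q^ j) (term j) ⟩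
    q^ j ⊛ ∑ j (term j)               ≈⟨ *-congˡ {q^ j} (sumP≋∑ j (term j)) ⟨
    q^ j ⊛ Psh j                      ∎

Ynum≋ : ∀ k → Ynum k ≋ H 0 k ⊕ H 0 (suc k)
Ynum≋ k = begin
  Psh k ⊕ + 2 · Psh (suc k) ⊕ Psh (suc (suc k))                 ≈⟨ +-congʳ {Psh (suc (suc k))} (+-congˡ {Psh k} (singleton-⊛ (+ 2) (Psh (suc k)))) ⟨
  Psh k ⊕ (1P ⊕ 1P) ⊛ Psh (suc k) ⊕ Psh (suc (suc k))           ≈⟨ regroup (Psh k) (Psh (suc k)) (Psh (suc (suc k))) ⟩
  (Psh k ⊕ Psh (suc k)) ⊕ (Psh (suc k) ⊕ Psh (suc (suc k)))     ≈⟨ +-cong {Psh k ⊕ Psh (suc k)} {H 0 k} (P+P k) (P+P (suc k)) ⟩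
  H 0 k ⊕ H 0 (suc k)                                           ∎
  where P+P = P+P≈H Psh odd ≋-refl odd-suc ≋-refl Psh-suc

-- Ballot numbers as constant polynomials, and the theorem.

β : ℕ → ℕ → Poly
β n k = ballot n k ∷ []

β-suc : ∀ n → Reflected (β n) (β (suc n))
β-suc n = record
  { at-zero = ∷-cong (ballot-suc-zero n) ≋-refl
  ; at-suc  = λ k → ∷-cong (≡.trans (ballot-suc-suc n k)
      (cong (λ x → ballot n k ℤ.+ x ℤ.+ ballot n (suc (suc k))) (≡.sym (ℤₚ.+-identityʳ _)))) ≋-refl }

β-above : ∀ n k → n ℕ.< k → β n k ≋ 0P
β-above n k n<k = ≋-trans (∷-cong (ballot-above n k n<k) ≋-refl) 0∷[]

theorem9p1 : Σ (ℕ → Poly) λ Y →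
    ((k : ℕ) → (qP ⊖ 1P) ⊛ Y k ≈ Ynum k)
    × ((n : ℕ) → ∃ λ D → (d : ℕ) → D ≤ d →
    ((1P ⊖ qP) ^P (2 * n)) ⊛ Gtrunc d n
    ≈ sumP (suc n) (λ k → ballot n k · Y k))
-- The coefficient of z^n is final from depth n on, so n itself is the witness for D.
theorem9p1 = Y , (λ k → coeffs (≋-trans ([q-1]Y≈H+H k) (≋-sym (Ynum≋ k)))) , λ n → n , λ d n≤d → coeffs (begin
  ((1P ⊖ qP) ^P (2 ℕ.* n)) ⊛ Gtrunc d n
    ≈⟨ *-cong {(1P ⊖ qP) ^P (2 ℕ.* n)} {s^ n} ([1-q]^2n≋s^ n) (f≈B cfTrunc cfTrunc-zero cfTrunc-suc n d n≤d) ⟩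
  s^ n ⊛ B 1 n
    ≈⟨ expansion qP-cancel 1-qP-cancel β ≋-refl β-suc β-above n (s^ n ⊛ B 1 n) (A₀≈B n) ⟩
  ∑ (suc n) (λ k → β n k ⊛ Y k)
    ≈⟨ ∑-cong-< (suc n) (λ k _ → singleton-⊛ (ballot n k) (Y k)) ⟩
  ∑ (suc n) (λ k → ballot n k · Y k)
    ≈⟨ sumP≋∑ (suc n) (λ k → ballot n k · Y k) ⟨
  sumP (suc n) (λ k → ballot n k · Y k) ∎)
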